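{- Let $c_1, c_2 \geq 1$, let $0 \leq \epsilon_{\mathrm{add}} \leq 1$, let $G = (V,E,\eta,w)$ be a $\beta$-balanced lossy flow graph with $\lambda_2(N_{\overline G}) \geq 20\beta$, and let $d\in \mathbb{R}_{\geq 0}^V$ be a vector that satisfies $d_G \leq d \leq c_1 d_G$; write $D = \mathrm{diag}(d)$. Furthermore, let $v \in \mathbb{R}^V$ be a unit vector such that $$v^\top (D^{ -1/2}L_G D^{ -1/2} + \epsilon_{\mathrm{add}} I)v \leq c_2\, \lambda_1(D^{ -1/2}L_G D^{ -1/2} + \epsilon_{\mathrm{add}} I).$$ Then, for $\lambda := v^\top (D^{ -1/2}L_G D^{ -1/2} + \epsilon_{\mathrm{add}} I)v$, $$\frac{(\lambda_2(N_{\overline G}))^2}{12c_1^2c_2^2}\left(I - (1 - \lambda)vv^\top\right) \preceq D^{ -1/2}L_GD^{ -1/2} + \epsilon_{\mathrm{add}} I \preceq \frac{24c_1c_2}{\lambda_2(N_{\overline G})}\left(I - (1 - \lambda)vv^\top\right).$$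
   Context: A weighted lossy flow graph $G=(V,E,\eta,w)$ has a finite vertex set $V$, a multiset $E$ of pairs $e=(a_e,b_e)$ of distinct vertices, flow multipliers $\eta\in\mathbb{R}^E_{\ge 1}$ and edge weights $w\in\mathbb{R}^E_{\ge 0}$. Its incidence matrix $B_G\in\mathbb{R}^{E\times V}$ has row $e$ equal to $\vec 1_{b_e}-\eta_e\vec 1_{a_e}$, where $\vec 1_i$ is the $i$-th standard unit vector. $L_G := B_G^\top\,\mathrm{diag}(w)\,B_G$ is its (lossy) Laplacian, $D_G$ is the diagonal matrix consisting of the diagonal entries of $L_G$, $d_G\in\mathbb{R}^V$ is the vector of these diagonal entries, and $N_G := D_G^{ -1/2}L_GD_G^{ -1/2}$. The smoothed graph $\overline G=(V,E,w)$ has the same vertices, edges and weights with all multipliers equal to $1$; $L_{\overline G}, D_{\overline G}, N_{\overline G}$ are its (ordinary graph) Laplacian, diagonal of the Laplacian, and normalized Laplacian. $G$ is $\beta$-balanced if $\eta_e\le 1+\beta$ for all $e\in E$. For a symmetric PSD matrix $M$, $\lambda_1(M)\le\lambda_2(M)\le\dots$ are its eigenvalues. $\preceq$ is the Loewner order; vector inequalities are entrywise. -}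

module Defs where

open import Algebra.Bundles using (CommutativeRing; Semiring)
open import Algebra.Structures using (IsCommutativeRing)
open import Data.Bool.Base using (if_then_else_)
open import Data.Fin.Base as Fin using (Fin; toℕ)
open import Data.Fin.Properties as Fin using ()
open import Data.Nat.Base using (ℕ; suc)
open import Data.Product.Base using (Σ-syntax; ∃; ∃-syntax; _×_; _,_; proj₁; proj₂)
open import Data.Sum.Base using (inj₁; inj₂)
open import Level using (0ℓ)
open import Relation.Binary.PropositionalEquality
open import Relation.Binary.Structures using (IsDecTotalOrder)
open import Relation.Nullary using (yes; no; does; contradiction)

-- The standard library has no real numbers.  They are taken axiomatically, as
-- a Dedekind-complete ordered field, which is unique up to isomorphism.  The
-- axioms are those of the classical reals: the order is decidable and every
-- nonempty predicate that is bounded above has a supremum.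
record RealNumbers : Set₁ where
  infix  4 _≤_
  infixl 6 _+_
  infixl 7 _*_
  infix  8 -_
  field
    Carrier           : Set
    _≤_               : Carrier → Carrier → Set
    _+_ _*_           : Carrier → Carrier → Carrier
    -_                : Carrier → Carrier
    0# 1#             : Carrier
    isCommutativeRing : IsCommutativeRing _≡_ _+_ _*_ -_ 0# 1#
    isDecTotalOrder   : IsDecTotalOrder _≡_ _≤_
    0≢1               : 0# ≢ 1#
    inverse           : ∀ x → x ≢ 0# → ∃[ y ] x * y ≡ 1#
    +-monoˡ-≤         : ∀ {x y} z → x ≤ y → x + z ≤ y + z
    *-nonNeg          : ∀ {x y} → 0# ≤ x → 0# ≤ y → 0# ≤ x * y
    supremum          : (P : Carrier → Set) → ∃ P → (∃[ b ] (∀ x → P x → x ≤ b)) →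
                        ∃[ s ] (∀ x → P x → x ≤ s) ×
                               (∀ b → (∀ x → P x → x ≤ b) → s ≤ b)

  commutativeRing : CommutativeRing 0ℓ 0ℓ
  commutativeRing = record { isCommutativeRing = isCommutativeRing }

module OverReals (reals : RealNumbers) where

  open RealNumbers reals public renaming (Carrier to ℝ)
  open CommutativeRing commutativeRing public
    using (_-_; ring; semiring; commutativeSemiring;
           +-comm; +-assoc; +-identityˡ; +-identityʳ; -‿inverseˡ; -‿inverseʳ;
           *-comm; *-assoc; *-identityˡ; distribˡ; distribʳ; zeroˡ)
  open IsDecTotalOrder isDecTotalOrder public
    using (_≟_; _≤?_; total)
    renaming (refl to ≤-refl; trans to ≤-trans; antisym to ≤-antisym;
              reflexive to ≤-reflexive)
  open import Algebra.Properties.Semiring.Sum semiring public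
    using (sum; sum-syntax)
  open import Algebra.Definitions.RawSemiring (Semiring.rawSemiring semiring) public
    using (_^_) renaming (_×_ to _·_)

  fromℕ : ℕ → ℝ
  fromℕ k = k · 1#

  -- Total inverse and division, with 0⁻¹ = 0.
  infix 9 _⁻¹
  _⁻¹ : ℝ → ℝ
  x ⁻¹ with x ≟ 0#
  ... | yes _   = 0#
  ... | no  x≢0 = proj₁ (inverse x x≢0)

  infixl 7 _/_
  _/_ : ℝ → ℝ → ℝ
  x / y = x * y ⁻¹

  module OrderedField where
    open import Algebra.Properties.Ring ring using (-‿distribˡ-*; -‿distribʳ-*; -‿involutive)
    open import Algebra.Solver.Ring.NaturalCoefficients.Default commutativeSemiring
      using (solve; _:+_; _:*_; _:=_; con)

    ≤-substˡ : ∀ {a b c} → a ≡ b → a ≤ c → b ≤ c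
    ≤-substˡ refl p = p

    ≤-substʳ : ∀ {a b c} → a ≡ b → c ≤ a → c ≤ b
    ≤-substʳ refl p = p

    ≤-subst₂ : ∀ {a b c d} → a ≡ b → c ≡ d → a ≤ c → b ≤ d
    ≤-subst₂ refl refl p = p

    *-inverseʳ : ∀ {x} → x ≢ 0# → x * x ⁻¹ ≡ 1#
    *-inverseʳ {x} x≢0 with x ≟ 0#
    ... | yes x≡0 = contradiction x≡0 x≢0
    ... | no  p   = proj₂ (inverse x p)

    sub-add : ∀ x y → (y - x) + x ≡ y
    sub-add x y = trans (+-assoc y (- x) x)
      (trans (cong (y +_) (-‿inverseˡ x)) (+-identityʳ y))

    neg² : ∀ x → - x * - x ≡ x * x
    neg² x = trans (sym (-‿distribˡ-* x (- x)))
      (trans (cong -_ (sym (-‿distribʳ-* x x))) (-‿involutive (x * x)))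

    mul-diff : ∀ x y z → (y - x) * z + x * z ≡ y * z
    mul-diff x y z = trans (sym (distribʳ z (y - x) x)) (cong (_* z) (sub-add x y))

    mid²′ : ∀ h k r → (h + h) * (h + h) * ((k + r) * r) + (h * k) * (h * k) ≡
                      (h * ((k + r) + r)) * (h * ((k + r) + r))
    mid²′ = solve 3 (λ h k r →
      (h :+ h) :* (h :+ h) :* ((k :+ r) :* r) :+ (h :* k) :* (h :* k) :=
      (h :* ((k :+ r) :+ r)) :* (h :* ((k :+ r) :+ r))) refl

    mid² : ∀ h s r → (h + h) * (h + h) * (s * r) + (h * (s - r)) * (h * (s - r)) ≡
                     (h * (s + r)) * (h * (s + r))
    mid² h s r = subst
      (λ z → (h + h) * (h + h) * (z * r) + (h * (s - r)) * (h * (s - r)) ≡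
             (h * (z + r)) * (h * (z + r)))
      (sub-add r s) (mid²′ h (s - r) r)

    expand : ∀ h s r → s * (h * (s + r)) ≡ h * (s * s) + h * (s * r)
    expand = solve 3 (λ h s r → s :* (h :* (s :+ r)) := h :* (s :* s) :+ h :* (s :* r)) refl

    sq-suc : ∀ x → (1# + x) * (1# + x) ≡ (1# + x + x * x) + x
    sq-suc = solve 1 (λ x → (con 1 :+ x) :* (con 1 :+ x) :=
                            (con 1 :+ x :+ x :* x) :+ x) refl

    +-mono : ∀ {a b c d} → a ≤ b → c ≤ d → a + c ≤ b + d
    +-mono {a} {b} {c} {d} p q = ≤-trans (+-monoˡ-≤ c p)
      (≤-subst₂ (+-comm c b) (+-comm d b) (+-monoˡ-≤ b q))

    0≤- : ∀ {x y} → x ≤ y → 0# ≤ y - x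
    0≤- {x} p = ≤-substˡ (-‿inverseʳ x) (+-monoˡ-≤ (- x) p)

    ≤+ : ∀ {a b} → 0# ≤ b → a ≤ b + a
    ≤+ {a} p = ≤-substˡ (+-identityˡ a) (+-monoˡ-≤ a p)

    +-cancelʳ : ∀ {a b} c → a + c ≤ b + c → a ≤ b
    +-cancelʳ {a} {b} c p = ≤-subst₂ (e a) (e b) (+-monoˡ-≤ (- c) p)
      where
      e : ∀ a → (a + c) + - c ≡ a
      e a = trans (+-assoc a c (- c)) (trans (cong (a +_) (-‿inverseʳ c)) (+-identityʳ a))

    *-monoʳ : ∀ {x y z} → 0# ≤ z → x ≤ y → x * z ≤ y * z
    *-monoʳ {x} {y} {z} 0≤z p =
      ≤-substʳ (mul-diff x y z) (≤+ (*-nonNeg (0≤- p) 0≤z))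

    *-monoˡ : ∀ {x y z} → 0# ≤ z → x ≤ y → z * x ≤ z * y
    *-monoˡ {x} {y} {z} 0≤z p = ≤-subst₂ (*-comm x z) (*-comm y z) (*-monoʳ 0≤z p)

    0≤x² : ∀ x → 0# ≤ x * x
    0≤x² x with total 0# x
    ... | inj₁ p = *-nonNeg p p
    ... | inj₂ p = ≤-substʳ (neg² x) (*-nonNeg q q)
      where
      q : 0# ≤ - x
      q = ≤-substʳ (+-identityˡ (- x)) (0≤- p)

    0≤1 : 0# ≤ 1#
    0≤1 = ≤-substʳ (*-identityˡ 1#) (0≤x² 1#)

    1≤⇒≢0 : ∀ {x} → 1# ≤ x → x ≢ 0#
    1≤⇒≢0 p refl = 0≢1 (≤-antisym 0≤1 p)

    0≤⁻¹ : ∀ {x} → 0# ≤ x → x ≢ 0# → 0# ≤ x ⁻¹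
    0≤⁻¹ {x} 0≤x x≢0 = ≤-substʳ
      (trans (sym (*-assoc x (x ⁻¹) (x ⁻¹)))
        (trans (cong (_* x ⁻¹) (*-inverseʳ x≢0)) (*-identityˡ (x ⁻¹))))
      (*-nonNeg 0≤x (0≤x² (x ⁻¹)))

    *-cancelʳ : ∀ {a b t} → 0# ≤ t → t ≢ 0# → a * t ≤ b * t → a ≤ b
    *-cancelʳ {a} {b} {t} 0≤t t≢0 p =
      ≤-subst₂ (e a) (e b) (*-monoʳ (0≤⁻¹ 0≤t t≢0) p)
      where
      e : ∀ a → a * t * t ⁻¹ ≡ a
      e a = trans (*-assoc a t (t ⁻¹))
        (trans (cong (a *_) (*-inverseʳ t≢0)) (trans (*-comm a 1#) (*-identityˡ a)))

    bound : ∀ {x y t} → 0# ≤ t → t ≢ 0# → x ≤ t * t → y * y ≤ x → y ≤ t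
    bound {x} {y} {t} 0≤t t≢0 x≤t² y²≤x with total y t
    ... | inj₁ y≤t = y≤t
    ... | inj₂ t≤y = *-cancelʳ 0≤t t≢0
      (≤-trans (*-monoˡ (≤-trans 0≤t t≤y) t≤y) (≤-trans y²≤x x≤t²))

    2≢0 : 1# + 1# ≢ 0#
    2≢0 = 1≤⇒≢0 (≤+ 0≤1)

    ½ : ℝ
    ½ = (1# + 1#) ⁻¹

    ½+½ : ½ + ½ ≡ 1#
    ½+½ = trans (sym (cong₂ _+_ (*-identityˡ ½) (*-identityˡ ½)))
      (trans (sym (distribʳ ½ 1# 1#)) (*-inverseʳ 2≢0))

    halves : ∀ a → ½ * a + ½ * a ≡ a
    halves a = trans (sym (distribʳ a ½ ½)) (trans (cong (_* a) ½+½) (*-identityˡ a))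

    0≤½ : 0# ≤ ½
    0≤½ = 0≤⁻¹ (≤-trans 0≤1 (≤+ 0≤1)) 2≢0

    ½-cancel : ∀ {a b} → ½ * a ≤ ½ * b → a ≤ b
    ½-cancel {a} {b} p = ≤-subst₂ (halves a) (halves b) (+-mono p p)

  open OrderedField

  sqrt-exists : ∀ x → 0# ≤ x → ∃[ s ] 0# ≤ s × s * s ≡ x
  sqrt-exists x 0≤x with x ≟ 0#
  ... | yes refl = 0# , ≤-refl , zeroˡ 0#
  ... | no x≢0 = s , 0≤s , ≤-antisym s²≤x x≤s²
    where
    P : ℝ → Set
    P y = y * y ≤ x

    P0 : P 0#
    P0 = ≤-substˡ (sym (zeroˡ 0#)) 0≤x

    1≤1+x : 1# ≤ 1# + x
    1≤1+x = ≤-substʳ (+-comm x 1#) (≤+ 0≤x)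

    0≤1+x : 0# ≤ 1# + x
    0≤1+x = ≤-trans 0≤1 1≤1+x

    upper : ∀ y → P y → y ≤ 1# + x
    upper y = bound 0≤1+x (1≤⇒≢0 1≤1+x)
      (≤-substʳ (sym (sq-suc x))
        (≤+ (≤-trans 0≤1+x (≤-substˡ (+-identityʳ (1# + x)) (+-mono ≤-refl (0≤x² x))))))

    sup = supremum P (0# , P0) (1# + x , upper)
    s   = proj₁ sup

    ub : ∀ y → P y → y ≤ s
    ub = proj₁ (proj₂ sup)

    0≤s : 0# ≤ s
    0≤s = ub 0# P0

    s≢0 : s ≢ 0#
    s≢0 s≡0 with total x 1#
    ... | inj₁ x≤1 = x≢0 (≤-antisym (≤-substʳ s≡0
            (ub x (≤-substʳ (*-identityˡ x) (*-monoʳ 0≤x x≤1)))) 0≤x)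
    ... | inj₂ 1≤x = 1≤⇒≢0 (ub 1# (≤-substˡ (sym (*-identityˡ 1#)) 1≤x)) s≡0

    r t q : ℝ
    r = x * s ⁻¹
    t = ½ * (s + r)
    q = x * t ⁻¹

    cancel : ∀ {u} → u ≢ 0# → (x * u ⁻¹) * u ≡ x
    cancel {u} u≢0 = trans (*-assoc x (u ⁻¹) u)
      (trans (cong (x *_) (trans (*-comm (u ⁻¹) u) (*-inverseʳ u≢0)))
        (trans (*-comm x 1#) (*-identityˡ x)))

    sr≡x : s * r ≡ x
    sr≡x = trans (*-comm s r) (cancel s≢0)

    0≤r : 0# ≤ r
    0≤r = *-nonNeg 0≤x (0≤⁻¹ 0≤s s≢0)

    ½s≤t : ½ * s ≤ t
    ½s≤t = ≤-substʳ (trans (+-comm _ _) (sym (distribˡ ½ s r)))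
      (≤+ (*-nonNeg 0≤½ 0≤r))

    0≤t : 0# ≤ t
    0≤t = ≤-trans (*-nonNeg 0≤½ 0≤s) ½s≤t

    t≢0 : t ≢ 0#
    t≢0 t≡0 = s≢0 (≤-antisym (½-cancel (≤-substʳ
      (trans t≡0 (sym (trans (*-comm ½ 0#) (zeroˡ ½)))) ½s≤t)) 0≤s)

    k : ℝ
    k = ½ * (s - r)

    x-as-product : x ≡ (½ + ½) * (½ + ½) * (s * r)
    x-as-product = sym (trans
      (cong (_* (s * r)) (trans (cong₂ _*_ ½+½ ½+½) (*-identityˡ 1#)))
      (trans (*-identityˡ (s * r)) sr≡x))

    x≤t² : x ≤ t * t
    x≤t² = ≤-substʳ
      (trans (+-comm (k * k) x)
        (trans (cong (_+ k * k) x-as-product) (mid² ½ s r)))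
      (≤+ (0≤x² k))

    s≤t : s ≤ t
    s≤t = proj₂ (proj₂ sup) t (λ y → bound 0≤t t≢0 x≤t²)

    s≤r : s ≤ r
    s≤r = ½-cancel (+-cancelʳ (½ * s) (≤-subst₂ (sym (halves s))
            (trans (distribˡ ½ s r) (+-comm _ _)) s≤t))

    s²≤x : s * s ≤ x
    s²≤x = ≤-substʳ sr≡x (*-monoˡ 0≤s s≤r)

    q≤t : q ≤ t
    q≤t = *-cancelʳ 0≤t t≢0 (≤-substˡ (sym (cancel t≢0)) x≤t²)

    q≤s : q ≤ s
    q≤s = ub q (≤-substʳ (cancel t≢0)
            (*-monoˡ (*-nonNeg 0≤x (0≤⁻¹ 0≤t t≢0)) q≤t))

    x≤s² : x ≤ s * s
    x≤s² = ½-cancel (+-cancelʳ (½ * x) (≤-subst₂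
      (trans (cancel t≢0) (sym (halves x)))
      (trans (expand ½ s r) (cong (λ z → ½ * (s * s) + ½ * z) sr≡x))
      (*-monoʳ 0≤t q≤s)))

  -- Only used on nonnegative arguments; negative ones are sent to 0.
  √_ : ℝ → ℝ
  √ x with 0# ≤? x
  ... | yes 0≤x = proj₁ (sqrt-exists x 0≤x)
  ... | no  _   = 0#

  Vec : ℕ → Set
  Vec n = Fin n → ℝ

  Matrix : ℕ → ℕ → Set
  Matrix m n = Fin m → Fin n → ℝ

  δ : ∀ {n} → Fin n → Fin n → ℝ
  δ i j = if does (i Fin.≟ j) then 1# else 0#

  I : ∀ {n} → Matrix n n
  I = δ

  diag : ∀ {n} → Vec n → Matrix n n
  diag d i j = d i * δ i j

  diagonal : ∀ {n} → Matrix n n → Vec n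
  diagonal M i = M i i

  infixl 6 _⊞_ _⊟_
  infixl 7 _⊠_
  infixr 7 _⊡_
  infix  9 _ᵀ

  _ᵀ : ∀ {m n} → Matrix m n → Matrix n m
  (M ᵀ) i j = M j i

  _⊞_ _⊟_ : ∀ {m n} → Matrix m n → Matrix m n → Matrix m n
  (M ⊞ N) i j = M i j + N i j
  (M ⊟ N) i j = M i j - N i j

  _⊡_ : ∀ {m n} → ℝ → Matrix m n → Matrix m n
  (c ⊡ M) i j = c * M i j

  _⊠_ : ∀ {l m n} → Matrix l m → Matrix m n → Matrix l n
  (_⊠_ {m = m} M N) i j = ∑[ k < m ] (M i k * N k j)

  infixr 7 _⊠ᵛ_
  _⊠ᵛ_ : ∀ {m n} → Matrix m n → Vec n → Vec m
  (_⊠ᵛ_ {n = n} M x) i = ∑[ j < n ] (M i j * x j)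

  ⟨_,_⟩ : ∀ {n} → Vec n → Vec n → ℝ
  ⟨_,_⟩ {n} x y = ∑[ i < n ] (x i * y i)

  outer : ∀ {n} → Vec n → Vec n → Matrix n n
  outer x y i j = x i * y j

  quadForm : ∀ {n} → Matrix n n → Vec n → ℝ
  quadForm M x = ⟨ x , M ⊠ᵛ x ⟩

  IsUnit : ∀ {n} → Vec n → Set
  IsUnit v = ⟨ v , v ⟩ ≡ 1#

  infix 4 _≤ᵛ_
  _≤ᵛ_ : ∀ {n} → Vec n → Vec n → Set
  x ≤ᵛ y = ∀ i → x i ≤ y i

  record IsPSD {n} (M : Matrix n n) : Set where
    field
      symmetric : ∀ i j → M i j ≡ M j i
      nonNeg    : ∀ x → 0# ≤ quadForm M x

  infix 4 _⪯_
  _⪯_ : ∀ {n} → Matrix n n → Matrix n n → Set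
  M ⪯ N = IsPSD (N ⊟ M)

  -- The nondecreasing list of eigenvalues of a symmetric matrix, counted with
  -- multiplicity, with an orthonormal basis of eigenvectors.  By the spectral
  -- theorem there is one, and its eigenvalues are unique.
  record Spectrum {n} (M : Matrix n n) : Set where
    field
      eigenvalue     : Fin n → ℝ
      eigenvector    : Fin n → Vec n
      nondecreasing  : ∀ {i j} → i Fin.≤ j → eigenvalue i ≤ eigenvalue j
      orthonormal    : ∀ i j → ⟨ eigenvector i , eigenvector j ⟩ ≡ δ i j
      eigen-equation : ∀ i k → (M ⊠ᵛ eigenvector i) k ≡ eigenvalue i * eigenvector i k

  -- ℓ Isλ[ k ] M says that λₖ(M) exists and equals ℓ; k counts from 1.
  infix 4 _Isλ[_]_
  _Isλ[_]_ : ∀ {n} → ℝ → ℕ → Matrix n n → Set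
  _Isλ[_]_ {n} ℓ k M =
    Σ[ S ∈ Spectrum M ] Σ[ i ∈ Fin n ] suc (toℕ i) ≡ k × Spectrum.eigenvalue S i ≡ ℓ

  -- The vertex set is Fin n; indexing edges by Fin m allows parallel edges.
  record LossyFlowGraph (n : ℕ) : Set where
    field
      m   : ℕ
      a b : Fin m → Fin n
      a≢b : ∀ e → a e ≢ b e
      η   : Fin m → ℝ
      1≤η : ∀ e → 1# ≤ η e
      w   : Fin m → ℝ
      0≤w : ∀ e → 0# ≤ w e

  smoothed : ∀ {n} → LossyFlowGraph n → LossyFlowGraph n
  smoothed G = record
    { m   = m
    ; a   = a
    ; b   = b
    ; a≢b = a≢b
    ; η   = λ _ → 1#
    ; 1≤η = λ _ → ≤-refl
    ; w   = w
    ; 0≤w = 0≤w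
    }
    where open LossyFlowGraph G

  Balanced : ∀ {n} → ℝ → LossyFlowGraph n → Set
  Balanced β G = ∀ e → η e ≤ 1# + β
    where open LossyFlowGraph G

  incidence : ∀ {n} (G : LossyFlowGraph n) → Matrix (LossyFlowGraph.m G) n
  incidence G e i = δ (b e) i - η e * δ (a e) i
    where open LossyFlowGraph G

  laplacian : ∀ {n} → LossyFlowGraph n → Matrix n n
  laplacian G = incidence G ᵀ ⊠ diag (LossyFlowGraph.w G) ⊠ incidence G

  degree : ∀ {n} → LossyFlowGraph n → Vec n
  degree G = diagonal (laplacian G)

  -- diag(d)^{-1/2}, with 0^{-1/2} = 0 (the pseudoinverse convention).
  diag^-½ : ∀ {n} → Vec n → Matrix n n
  diag^-½ d = diag (λ i → (√ d i) ⁻¹)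

  scaledLaplacian : ∀ {n} → Vec n → LossyFlowGraph n → Matrix n n
  scaledLaplacian d G = diag^-½ d ⊠ laplacian G ⊠ diag^-½ d

  normalizedLaplacian : ∀ {n} → LossyFlowGraph n → Matrix n n
  normalizedLaplacian G = scaledLaplacian (degree G) G

{-# OPTIONS --safe #-}

-- Write μ = λ₂(N of the smoothed graph), A = D^{-1/2} L D^{-1/2} and M = A + ε I, and
-- split x = α v + u with u ⊥ v, so that x is mapped by the quadratic form of
-- P = I - (1 - ℓ) v vᵀ to ‖u‖² + ℓ α².
--
-- Upper bound: L ⪯ 2 diag(degree) gives M ⪯ 3 I, whence xᵀMx ≤ 2 α² ℓ + 2 uᵀMu ≤ 6 xᵀPx,
-- and μ ≤ 2.
--
-- Lower bound: for μ = 0 there is nothing to prove.  Otherwise no vertex is isolated, and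
-- 20 (η - 1) ≤ μ ≤ 2 makes L a small perturbation of the smoothed Laplacian: on vectors
-- y = D^{1/2} z such that z has mean 0 with respect to the smoothed degrees,
-- μ ‖y‖² ≤ 2 c₁ yᵀMy.  By Courant–Fischer the same bound holds on the orthogonal complement
-- of the lowest eigenvector f of M.  Applied to the components orthogonal to f of v, which is
-- nearly a minimizer, and of x, it yields μ ‖u‖² ≤ 2 c₁ (1 + c₂) xᵀMx; the remaining term is
-- bounded by ℓ α² ≤ c₂ λ₁ ‖x‖² ≤ c₂ xᵀMx.

module Submission where

open import Defs
open import Algebra.Bundles using (CommutativeRing)
open import Algebra.Solver.Ring.AlmostCommutativeRing using (fromCommutativeRing; _-Raw-AlmostCommutative⟶_)
open import Data.Fin.Base as Fin using (Fin; zero; suc; toℕ)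
open import Data.Fin.Properties as Fin using ()
open import Data.Integer.Base as ℤ using (ℤ; -[1+_]; _⊖_)
open import Data.Integer.Properties as ℤ using ()
open import Data.Maybe.Base as Maybe using (Maybe)
open import Data.Nat.Base as ℕ using (ℕ; zero; suc)
open import Data.Nat.Properties as ℕ using ()
open import Data.Product.Base using (∃-syntax; _×_; _,_; proj₁; proj₂)
open import Data.Sum.Base using (_⊎_; inj₁; inj₂; [_,_]′)
open import Function.Base using (_∘_)
open import Relation.Binary.PropositionalEquality
open import Relation.Nullary using (Dec; yes; no; contradiction)
open import Relation.Nullary.Decidable using (dec⇒maybe)

-- The lowest eigenvector mediates between the two. The 20 in the hypothesis gives η - 1 ≤ 1/10,
-- hence 4 η² ≤ 5, and 200 (η - 1)² ≤ μ, of which 48 (η - 1)² ≤ μ is enough. The 5/4 is the price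
-- for exchanging lossy and smoothed degrees, the 1/48 bounds the loss of energy, and together they
-- leave exactly the factor 2 c₁. The 12 of the lower bound is 8 + 4, the shares of ‖u‖² and of ℓ
-- α². One factor of μ² is consumed by the bound on ‖u‖²; the remaining ones are replaced by 2. In
-- the upper bound μ ≤ 2 turns the 6 into 12, which lies below 24 c₁ c₂.

-- A ring solver for the reals with integer coefficients.

module RealAlgebra (reals : RealNumbers) where

  open OverReals reals
  open OrderedField
  open import Algebra.Properties.Ring ring
    using (-‿distribˡ-*; -‿distribʳ-*; -‿involutive; -0#≈0#; -‿+-comm)
  open import Algebra.Properties.Semiring.Mult.TCOptimised semiring
    using (×-homo-+; ×1-homo-*; ×ᵤ≈×) renaming (_×_ to _·ₒ_)

  -- Unlike fromℕ 1, num 1 is definitionally 1#.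
  num : ℕ → ℝ
  num k = k ·ₒ 1#

  fromℕ≡num : ∀ k → fromℕ k ≡ num k
  fromℕ≡num k = ×ᵤ≈× k 1#

  private

    fromℤ : ℤ → ℝ
    fromℤ (ℤ.+ n)    = num n
    fromℤ -[1+ n ] = - num (suc n)

    cancel-1+ : ∀ x y → x - y ≡ (1# + x) - (1# + y)
    cancel-1+ x y = begin
      x - y                   ≡⟨ cong (_- y) (+-identityʳ x) ⟨
      (x + 0#) - y            ≡⟨ cong (λ z → (x + z) - y) (-‿inverseʳ 1#) ⟨
      (x + (1# - 1#)) - y     ≡⟨ cong (_- y) (+-assoc x 1# (- 1#)) ⟨
      (x + 1# - 1#) - y       ≡⟨ +-assoc (x + 1#) (- 1#) (- y) ⟩
      (x + 1#) + (- 1# - y)   ≡⟨ cong₂ _+_ (+-comm x 1#) (-‿+-comm 1# y) ⟩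
      (1# + x) - (1# + y)     ∎
      where open ≡-Reasoning

    x-0 : ∀ x → x - 0# ≡ x
    x-0 x = trans (cong (x +_) -0#≈0#) (+-identityʳ x)

    ⊖-homo : ∀ m n → fromℤ (m ⊖ n) ≡ num m - num n
    ⊖-homo m       zero    = sym (x-0 (num m))
    ⊖-homo zero    (suc n) = sym (+-identityˡ _)
    ⊖-homo (suc m) (suc n) = begin
      fromℤ (suc m ⊖ suc n)           ≡⟨ cong fromℤ (ℤ.[1+m]⊖[1+n]≡m⊖n m n) ⟩
      fromℤ (m ⊖ n)                   ≡⟨ ⊖-homo m n ⟩
      num m - num n                   ≡⟨ cancel-1+ (num m) (num n) ⟩
      (1# + num m) - (1# + num n)     ≡⟨ cong₂ _-_ (×-homo-+ 1# 1 m) (×-homo-+ 1# 1 n) ⟨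
      num (suc m) - num (suc n)       ∎
      where open ≡-Reasoning

    +-homo : ∀ i j → fromℤ (i ℤ.+ j) ≡ fromℤ i + fromℤ j
    +-homo (ℤ.+ m)    (ℤ.+ n)    = ×-homo-+ 1# m n
    +-homo (ℤ.+ m)    -[1+ n ] = ⊖-homo m (suc n)
    +-homo -[1+ m ] (ℤ.+ n)    = trans (⊖-homo n (suc m)) (+-comm _ _)
    +-homo -[1+ m ] -[1+ n ] = begin
      - num (suc (suc (m ℕ.+ n)))      ≡⟨ cong (-_ ∘ num ∘ suc) (ℕ.+-suc m n) ⟨
      - num (suc m ℕ.+ suc n)          ≡⟨ cong -_ (×-homo-+ 1# (suc m) (suc n)) ⟩
      - (num (suc m) + num (suc n))    ≡⟨ -‿+-comm _ _ ⟨
      - num (suc m) - num (suc n)      ∎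
      where open ≡-Reasoning

    neg-homo : ∀ i → fromℤ (ℤ.- i) ≡ - fromℤ i
    neg-homo (ℤ.+ zero)  = sym -0#≈0#
    neg-homo (ℤ.+ suc n) = refl
    neg-homo -[1+ n ]  = sym (-‿involutive _)

    *-homo-pos : ∀ m j → fromℤ (ℤ.+ m ℤ.* j) ≡ num m * fromℤ j
    *-homo-pos m (ℤ.+ n)    = trans (cong fromℤ (sym (ℤ.pos-* m n))) (×1-homo-* m n)
    *-homo-pos m -[1+ n ] = begin
      fromℤ (ℤ.+ m ℤ.* ℤ.- (ℤ.+ suc n))     ≡⟨ cong fromℤ (ℤ.neg-distribʳ-* (ℤ.+ m) (ℤ.+ suc n)) ⟨
      fromℤ (ℤ.- (ℤ.+ m ℤ.* ℤ.+ suc n))     ≡⟨ neg-homo (ℤ.+ m ℤ.* ℤ.+ suc n) ⟩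
      - fromℤ (ℤ.+ m ℤ.* ℤ.+ suc n)         ≡⟨ cong -_ (*-homo-pos m (ℤ.+ suc n)) ⟩
      - (num m * num (suc n))           ≡⟨ -‿distribʳ-* _ _ ⟩
      num m * - num (suc n)             ∎
      where open ≡-Reasoning

    *-homo : ∀ i j → fromℤ (i ℤ.* j) ≡ fromℤ i * fromℤ j
    *-homo (ℤ.+ m)    j = *-homo-pos m j
    *-homo -[1+ m ] j = begin
      fromℤ (ℤ.- (ℤ.+ suc m) ℤ.* j)       ≡⟨ cong fromℤ (ℤ.neg-distribˡ-* (ℤ.+ suc m) j) ⟨
      fromℤ (ℤ.- (ℤ.+ suc m ℤ.* j))       ≡⟨ neg-homo (ℤ.+ suc m ℤ.* j) ⟩
      - fromℤ (ℤ.+ suc m ℤ.* j)           ≡⟨ cong -_ (*-homo-pos (suc m) j) ⟩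
      - (num (suc m) * fromℤ j)         ≡⟨ -‿distribˡ-* _ _ ⟩
      - num (suc m) * fromℤ j           ∎
      where open ≡-Reasoning

    homomorphism : CommutativeRing.rawRing ℤ.+-*-commutativeRing
                   -Raw-AlmostCommutative⟶ fromCommutativeRing commutativeRing
    homomorphism = record
      { ⟦_⟧    = fromℤ
      ; +-homo = +-homo
      ; *-homo = *-homo
      ; -‿homo = neg-homo
      ; 0-homo = refl
      ; 1-homo = refl
      }

    -- The solver only asks for soundness, so comparing integers is enough and no injectivity of
    -- `fromℤ` has to be shown.
    coefficient≟ : ∀ i j → Maybe (fromℤ i ≡ fromℤ j)
    coefficient≟ i j = Maybe.map (cong fromℤ) (dec⇒maybe (i ℤ.≟ j))

  open import Algebra.Solver.Ring (CommutativeRing.rawRing ℤ.+-*-commutativeRing)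
    (fromCommutativeRing commutativeRing) homomorphism coefficient≟ public
    using (Polynomial; solve; _:+_; _:*_; _:-_; :-_; _:=_; con)

  nat : ∀ {m} → ℕ → Polynomial m
  nat k = con (ℤ.+ k)

-- Finite sums, inner products and quadratic forms.

module LinearAlgebra (reals : RealNumbers) where

  open OverReals reals
  open OrderedField
  open RealAlgebra reals
  open import Algebra.Properties.Semiring.Sum semiring
    using (sum-cong-≗; ∑-distrib-+; ∑-comm; *-distribˡ-sum; *-distribʳ-sum; sum-replicate-zero)

  private
    variable
      m n : ℕ

  zeroʳ : ∀ x → x * 0# ≡ 0#
  zeroʳ x = trans (*-comm x 0#) (zeroˡ x)

  -- The usual shape of an inequality proof below: `t` is an explicit slack, a sum of products of
  -- visibly nonnegative factors, and the identity is left to the ring solver.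
  ≤-by : ∀ {x y} t → 0# ≤ t → y ≡ x + t → x ≤ y
  ≤-by {x} t 0≤t y≡x+t = ≤-substʳ (trans (+-comm t x) (sym y≡x+t)) (≤+ 0≤t)

  +-nonNeg : ∀ {x y} → 0# ≤ x → 0# ≤ y → 0# ≤ x + y
  +-nonNeg 0≤x 0≤y = ≤-substˡ (+-identityˡ 0#) (+-mono 0≤x 0≤y)

  num-nonNeg : ∀ k → 0# ≤ num k
  num-nonNeg k = ≤-substʳ (fromℕ≡num k) (go k)
    where
    go : ∀ k → 0# ≤ fromℕ k
    go zero    = ≤-refl
    go (suc k) = +-nonNeg 0≤1 (go k)

  x*y≡0⇒x≡0⊎y≡0 : ∀ {x y} → x * y ≡ 0# → x ≡ 0# ⊎ y ≡ 0#
  x*y≡0⇒x≡0⊎y≡0 {x} {y} xy≡0 with x ≟ 0#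
  ... | yes x≡0 = inj₁ x≡0
  ... | no  x≢0 = inj₂ (begin
    y                   ≡⟨ *-identityˡ y ⟨
    1# * y              ≡⟨ cong (_* y) (*-inverseʳ x≢0) ⟨
    x * x ⁻¹ * y        ≡⟨ solve 3 (λ x i y → x :* i :* y := i :* (x :* y)) refl x (x ⁻¹) y ⟩
    x ⁻¹ * (x * y)      ≡⟨ cong (x ⁻¹ *_) xy≡0 ⟩
    x ⁻¹ * 0#           ≡⟨ zeroʳ (x ⁻¹) ⟩
    0#                  ∎)
    where open ≡-Reasoning

  x²≡0⇒x≡0 : ∀ {x} → x * x ≡ 0# → x ≡ 0#
  x²≡0⇒x≡0 x²≡0 with x*y≡0⇒x≡0⊎y≡0 x²≡0
  ... | inj₁ x≡0 = x≡0
  ... | inj₂ x≡0 = x≡0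

  *-cancelˡ : ∀ {a b t} → 0# ≤ t → t ≢ 0# → t * a ≤ t * b → a ≤ b
  *-cancelˡ 0≤t t≢0 p = *-cancelʳ 0≤t t≢0 (≤-subst₂ (*-comm _ _) (*-comm _ _) p)

  sum-δ : ∀ (f : Vec n) i → ∑[ j < n ] (δ i j * f j) ≡ f i
  sum-δ {suc n} f zero = begin
    1# * f zero + ∑[ j < n ] (0# * f (suc j))
      ≡⟨ cong₂ _+_ (*-identityˡ _) (sum-cong-≗ {n = n} (λ j → zeroˡ (f (suc j)))) ⟩
    f zero + ∑[ j < n ] 0#
      ≡⟨ cong (f zero +_) (sum-replicate-zero n) ⟩
    f zero + 0#
      ≡⟨ +-identityʳ _ ⟩
    f zero ∎
    where open ≡-Reasoning
  sum-δ {suc n} f (suc i) = begin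
    0# * f zero + ∑[ j < n ] (δ i j * f (suc j))
      ≡⟨ cong₂ _+_ (zeroˡ _) (sum-δ (f ∘ suc) i) ⟩
    0# + f (suc i)
      ≡⟨ +-identityˡ _ ⟩
    f (suc i) ∎
    where open ≡-Reasoning

  δ-sym : ∀ (i j : Fin n) → δ i j ≡ δ j i
  δ-sym zero    zero    = refl
  δ-sym zero    (suc j) = refl
  δ-sym (suc i) zero    = refl
  δ-sym (suc i) (suc j) = δ-sym i j

  δ-refl : ∀ (i : Fin n) → δ i i ≡ 1#
  δ-refl zero    = refl
  δ-refl (suc i) = δ-refl i

  δ-≢ : ∀ {i j : Fin n} → i ≢ j → δ i j ≡ 0#
  δ-≢ {i = zero}  {zero}  i≢j = contradiction refl i≢j
  δ-≢ {i = zero}  {suc j} i≢j = refl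
  δ-≢ {i = suc i} {zero}  i≢j = refl
  δ-≢ {i = suc i} {suc j} i≢j = δ-≢ (i≢j ∘ cong suc)

  sum-mono : ∀ {f g : Vec n} → f ≤ᵛ g → sum f ≤ sum g
  sum-mono {zero}  f≤g = ≤-refl
  sum-mono {suc n} f≤g = +-mono (f≤g zero) (sum-mono (f≤g ∘ suc))

  sum-nonNeg : ∀ {f : Vec n} → (∀ i → 0# ≤ f i) → 0# ≤ sum f
  sum-nonNeg {n} 0≤f = ≤-substˡ (sum-replicate-zero n) (sum-mono 0≤f)

  term≤sum : ∀ {f : Vec n} → (∀ i → 0# ≤ f i) → ∀ i → f i ≤ sum f
  term≤sum {suc n} 0≤f zero    = ≤-by _ (sum-nonNeg (0≤f ∘ suc)) refl
  term≤sum {suc n} 0≤f (suc i) = ≤-trans (term≤sum (0≤f ∘ suc) i) (≤+ (0≤f zero))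

  sum≡0⇒term≡0 : ∀ {f : Vec n} → (∀ i → 0# ≤ f i) → sum f ≡ 0# → ∀ i → f i ≡ 0#
  sum≡0⇒term≡0 0≤f ∑≡0 i = ≤-antisym (≤-substʳ ∑≡0 (term≤sum 0≤f i)) (0≤f i)

  sum-linear : ∀ a (f : Vec n) b (g : Vec n) →
               ∑[ i < n ] (a * f i + b * g i) ≡ a * sum f + b * sum g
  sum-linear {n} a f b g = trans (∑-distrib-+ {n} _ _)
    (sym (cong₂ _+_ (*-distribˡ-sum {n} a f) (*-distribˡ-sum {n} b g)))

  ⟨⟩-comm : ∀ (x y : Vec n) → ⟨ x , y ⟩ ≡ ⟨ y , x ⟩
  ⟨⟩-comm {n} x y = sum-cong-≗ {n} (λ i → *-comm (x i) (y i))

  ⟨⟩-cong : ∀ {x x′ y y′ : Vec n} → x ≗ x′ → y ≗ y′ → ⟨ x , y ⟩ ≡ ⟨ x′ , y′ ⟩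
  ⟨⟩-cong {n} p q = sum-cong-≗ {n} (λ i → cong₂ _*_ (p i) (q i))

  ‖_‖² : Vec n → ℝ
  ‖ x ‖² = ⟨ x , x ⟩

  ‖‖²-nonNeg : ∀ (x : Vec n) → 0# ≤ ‖ x ‖²
  ‖‖²-nonNeg x = sum-nonNeg (λ i → 0≤x² (x i))

  ‖‖²≡0 : ∀ (x : Vec n) → ‖ x ‖² ≡ 0# → ∀ i → x i ≡ 0#
  ‖‖²≡0 x x²≡0 i = x²≡0⇒x≡0 (sum≡0⇒term≡0 (λ i → 0≤x² (x i)) x²≡0 i)

  lin : ℝ → Vec n → ℝ → Vec n → Vec n
  lin a x b y i = a * x i + b * y i

  ⟨⟩-linˡ : ∀ a (x : Vec n) b y z → ⟨ lin a x b y , z ⟩ ≡ a * ⟨ x , z ⟩ + b * ⟨ y , z ⟩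
  ⟨⟩-linˡ {n} a x b y z = trans
    (sum-cong-≗ {n} (λ i → solve 5 (λ a x b y z →
      (a :* x :+ b :* y) :* z := a :* (x :* z) :+ b :* (y :* z)) refl a (x i) b (y i) (z i)))
    (sum-linear {n} a _ b _)

  ⟨⟩-linʳ : ∀ (z : Vec n) a x b y → ⟨ z , lin a x b y ⟩ ≡ a * ⟨ z , x ⟩ + b * ⟨ z , y ⟩
  ⟨⟩-linʳ z a x b y = trans (⟨⟩-comm z _) (trans (⟨⟩-linˡ a x b y z)
    (cong₂ (λ p q → a * p + b * q) (⟨⟩-comm x z) (⟨⟩-comm y z)))

  -- The three scalars enter through equations so that known norms and inner products appear in the
  -- result already substituted.
  ‖lin‖² : ∀ a (x : Vec n) b y {p q r} → ‖ x ‖² ≡ p → ⟨ x , y ⟩ ≡ q → ‖ y ‖² ≡ r →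
           ‖ lin a x b y ‖² ≡ a * a * p + num 2 * (a * b * q) + b * b * r
  ‖lin‖² a x b y refl refl refl = begin
    ‖ lin a x b y ‖²
      ≡⟨ ⟨⟩-linˡ a x b y _ ⟩
    a * ⟨ x , lin a x b y ⟩ + b * ⟨ y , lin a x b y ⟩
      ≡⟨ cong₂ (λ p q → a * p + b * q) (⟨⟩-linʳ x a x b y)
           (trans (⟨⟩-linʳ y a x b y) (cong (λ p → a * p + b * ‖ y ‖²) (⟨⟩-comm y x))) ⟩
    a * (a * ‖ x ‖² + b * ⟨ x , y ⟩) + b * (a * ⟨ x , y ⟩ + b * ‖ y ‖²)
      ≡⟨ solve 5 (λ a b p q r →
           a :* (a :* p :+ b :* q) :+ b :* (a :* q :+ b :* r) :=
           a :* a :* p :+ nat 2 :* (a :* b :* q) :+ b :* b :* r) refl a b ‖ x ‖² ⟨ x , y ⟩ ‖ y ‖² ⟩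
    a * a * ‖ x ‖² + num 2 * (a * b * ⟨ x , y ⟩) + b * b * ‖ y ‖² ∎
    where open ≡-Reasoning

  ⊠ᵛ-lin : ∀ (M : Matrix m n) a x b y i → (M ⊠ᵛ lin a x b y) i ≡ lin a (M ⊠ᵛ x) b (M ⊠ᵛ y) i
  ⊠ᵛ-lin M a x b y i = ⟨⟩-linʳ (M i) a x b y

  Symmetric : Matrix n n → Set
  Symmetric M = ∀ i j → M i j ≡ M j i

  self-adjoint : ∀ {M : Matrix n n} → Symmetric M → ∀ x y → ⟨ x , M ⊠ᵛ y ⟩ ≡ ⟨ M ⊠ᵛ x , y ⟩
  self-adjoint {n} {M} M-sym x y = begin
    ∑[ i < n ] (x i * ∑[ j < n ] (M i j * y j))
      ≡⟨ sum-cong-≗ {n} (λ i → *-distribˡ-sum {n} (x i) _) ⟩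
    ∑[ i < n ] ∑[ j < n ] (x i * (M i j * y j))
      ≡⟨ ∑-comm {n} {n} _ ⟩
    ∑[ j < n ] ∑[ i < n ] (x i * (M i j * y j))
      ≡⟨ sum-cong-≗ {n} (λ j → sum-cong-≗ {n} (λ i → trans
           (solve 3 (λ x a y → x :* (a :* y) := a :* x :* y) refl (x i) (M i j) (y j))
           (cong (λ a → a * x i * y j) (M-sym i j)))) ⟩
    ∑[ j < n ] ∑[ i < n ] (M j i * x i * y j)
      ≡⟨ sum-cong-≗ {n} (λ j → sym (*-distribʳ-sum {n} (y j) _)) ⟩
    ∑[ j < n ] ((∑[ i < n ] (M j i * x i)) * y j) ∎
    where open ≡-Reasoning

  quadForm-lin : ∀ {M : Matrix n n} → Symmetric M → ∀ a x b y →
    quadForm M (lin a x b y) ≡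
    a * a * quadForm M x + num 2 * (a * b * ⟨ x , M ⊠ᵛ y ⟩) + b * b * quadForm M y
  quadForm-lin {M = M} M-sym a x b y = begin
    ⟨ lin a x b y , M ⊠ᵛ lin a x b y ⟩
      ≡⟨ ⟨⟩-cong {x = lin a x b y} (λ _ → refl) (⊠ᵛ-lin M a x b y) ⟩
    ⟨ lin a x b y , lin a (M ⊠ᵛ x) b (M ⊠ᵛ y) ⟩
      ≡⟨ ⟨⟩-linˡ a x b y _ ⟩
    a * ⟨ x , lin a (M ⊠ᵛ x) b (M ⊠ᵛ y) ⟩ + b * ⟨ y , lin a (M ⊠ᵛ x) b (M ⊠ᵛ y) ⟩
      ≡⟨ cong₂ (λ p q → a * p + b * q)
           (⟨⟩-linʳ x a (M ⊠ᵛ x) b (M ⊠ᵛ y))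
           (trans (⟨⟩-linʳ y a (M ⊠ᵛ x) b (M ⊠ᵛ y))
             (cong (λ p → a * p + b * quadForm M y)
               (trans (self-adjoint M-sym y x) (⟨⟩-comm (M ⊠ᵛ y) x)))) ⟩
    a * (a * quadForm M x + b * c) + b * (a * c + b * quadForm M y)
      ≡⟨ solve 5 (λ a b p q r →
           a :* (a :* p :+ b :* q) :+ b :* (a :* q :+ b :* r) :=
           a :* a :* p :+ nat 2 :* (a :* b :* q) :+ b :* b :* r) refl a b (quadForm M x) c (quadForm M y) ⟩
    a * a * quadForm M x + num 2 * (a * b * c) + b * b * quadForm M y ∎
    where
    open ≡-Reasoning
    c = ⟨ x , M ⊠ᵛ y ⟩

  quadForm-⊞⊡ : ∀ (M : Matrix n n) c N x → quadForm (M ⊞ c ⊡ N) x ≡ quadForm M x + c * quadForm N x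
  quadForm-⊞⊡ {n} M c N x = begin
    ⟨ x , (M ⊞ c ⊡ N) ⊠ᵛ x ⟩
      ≡⟨ ⟨⟩-cong {x = x} (λ _ → refl) row ⟩
    ⟨ x , lin 1# (M ⊠ᵛ x) c (N ⊠ᵛ x) ⟩
      ≡⟨ ⟨⟩-linʳ x 1# (M ⊠ᵛ x) c (N ⊠ᵛ x) ⟩
    1# * quadForm M x + c * quadForm N x
      ≡⟨ cong (_+ c * quadForm N x) (*-identityˡ _) ⟩
    quadForm M x + c * quadForm N x ∎
    where
    open ≡-Reasoning
    row : (M ⊞ c ⊡ N) ⊠ᵛ x ≗ lin 1# (M ⊠ᵛ x) c (N ⊠ᵛ x)
    row i = trans
      (sum-cong-≗ {n} (λ j → solve 4 (λ p c q x →
        (p :+ c :* q) :* x := nat 1 :* (p :* x) :+ c :* (q :* x)) refl (M i j) c (N i j) (x j)))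
      (sum-linear {n} 1# _ c _)

  quadForm-⊟ : ∀ (M N : Matrix n n) x → quadForm (M ⊟ N) x ≡ quadForm M x - quadForm N x
  quadForm-⊟ {n} M N x = begin
    ⟨ x , (M ⊟ N) ⊠ᵛ x ⟩
      ≡⟨ ⟨⟩-cong {x = x} (λ _ → refl) row ⟩
    ⟨ x , lin 1# (M ⊠ᵛ x) (- 1#) (N ⊠ᵛ x) ⟩
      ≡⟨ ⟨⟩-linʳ x 1# (M ⊠ᵛ x) (- 1#) (N ⊠ᵛ x) ⟩
    1# * quadForm M x + - 1# * quadForm N x
      ≡⟨ solve 2 (λ p q → nat 1 :* p :+ (:- nat 1) :* q := p :- q) refl (quadForm M x) (quadForm N x) ⟩
    quadForm M x - quadForm N x ∎
    where
    open ≡-Reasoning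
    row : (M ⊟ N) ⊠ᵛ x ≗ lin 1# (M ⊠ᵛ x) (- 1#) (N ⊠ᵛ x)
    row i = trans
      (sum-cong-≗ {n} (λ j → solve 3 (λ p q x →
        (p :- q) :* x := nat 1 :* (p :* x) :+ (:- nat 1) :* (q :* x)) refl (M i j) (N i j) (x j)))
      (sum-linear {n} 1# _ (- 1#) _)

  quadForm-⊡ : ∀ c (M : Matrix n n) x → quadForm (c ⊡ M) x ≡ c * quadForm M x
  quadForm-⊡ {n} c M x = begin
    ∑[ i < n ] (x i * ∑[ j < n ] (c * M i j * x j))
      ≡⟨ sum-cong-≗ {n} (λ i → trans
           (cong (x i *_) (trans (sum-cong-≗ {n} (λ j → *-assoc c (M i j) (x j)))
             (sym (*-distribˡ-sum {n} c _))))
           (solve 3 (λ x c s → x :* (c :* s) := c :* (x :* s)) refl (x i) c _)) ⟩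
    ∑[ i < n ] (c * (x i * ∑[ j < n ] (M i j * x j)))
      ≡⟨ *-distribˡ-sum {n} c _ ⟨
    c * quadForm M x ∎
    where open ≡-Reasoning

  quadForm-I : ∀ (x : Vec n) → quadForm I x ≡ ‖ x ‖²
  quadForm-I x = ⟨⟩-cong {x = x} (λ _ → refl) (sum-δ x)

  quadForm-outer : ∀ (v x : Vec n) → quadForm (outer v v) x ≡ ⟨ x , v ⟩ * ⟨ x , v ⟩
  quadForm-outer {n} v x = begin
    ∑[ i < n ] (x i * ∑[ j < n ] (v i * v j * x j))
      ≡⟨ sum-cong-≗ {n} (λ i → trans
           (cong (x i *_) (trans
             (sum-cong-≗ {n} (λ j → solve 3 (λ a b c → a :* b :* c := a :* (c :* b)) refl (v i) (v j) (x j)))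
             (sym (*-distribˡ-sum {n} (v i) _))))
           (sym (*-assoc (x i) (v i) _))) ⟩
    ∑[ i < n ] (x i * v i * ⟨ x , v ⟩)
      ≡⟨ *-distribʳ-sum {n} ⟨ x , v ⟩ _ ⟨
    ⟨ x , v ⟩ * ⟨ x , v ⟩ ∎
    where open ≡-Reasoning

  -- The rows of the matrix whose columns are n orthonormal vectors have squared
  -- norms at most 1, and these norms sum to n; so each row has norm exactly 1.
  module Completeness (f : Fin n → Vec n) (orthonormal : ∀ k l → ⟨ f k , f l ⟩ ≡ δ k l) where

    private
      E : Matrix n n
      E i j = ∑[ k < n ] (f k i * f k j)

      E-f : ∀ i k → ⟨ E i , f k ⟩ ≡ f k i
      E-f i k = begin
        ∑[ j < n ] ((∑[ l < n ] (f l i * f l j)) * f k j)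
          ≡⟨ sum-cong-≗ {n} (λ j → *-distribʳ-sum {n} (f k j) _) ⟩
        ∑[ j < n ] ∑[ l < n ] (f l i * f l j * f k j)
          ≡⟨ ∑-comm {n} {n} _ ⟩
        ∑[ l < n ] ∑[ j < n ] (f l i * f l j * f k j)
          ≡⟨ sum-cong-≗ {n} (λ l → trans (sum-cong-≗ {n} (λ j → *-assoc (f l i) (f l j) (f k j)))
               (sym (*-distribˡ-sum {n} (f l i) _))) ⟩
        ∑[ l < n ] (f l i * ⟨ f l , f k ⟩)
          ≡⟨ sum-cong-≗ {n} (λ l → trans (*-comm (f l i) _)
               (cong (_* f l i) (trans (orthonormal l k) (δ-sym l k)))) ⟩
        ∑[ l < n ] (δ k l * f l i)
          ≡⟨ sum-δ (λ l → f l i) k ⟩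
        f k i ∎
        where open ≡-Reasoning

      -- `E` is symmetric and fixes every `f k`, so it is the projection onto their span; this is
      -- the diagonal of `E² = E`.
      ‖E‖² : ∀ i → ‖ E i ‖² ≡ E i i
      ‖E‖² i = begin
        ∑[ j < n ] (E i j * ∑[ k < n ] (f k i * f k j))
          ≡⟨ sum-cong-≗ {n} (λ j → *-distribˡ-sum {n} (E i j) _) ⟩
        ∑[ j < n ] ∑[ k < n ] (E i j * (f k i * f k j))
          ≡⟨ ∑-comm {n} {n} _ ⟩
        ∑[ k < n ] ∑[ j < n ] (E i j * (f k i * f k j))
          ≡⟨ sum-cong-≗ {n} (λ k → trans
               (sum-cong-≗ {n} (λ j → solve 3 (λ e a b → e :* (a :* b) := a :* (e :* b)) refl
                 (E i j) (f k i) (f k j)))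
               (trans (sym (*-distribˡ-sum {n} (f k i) _)) (cong (f k i *_) (E-f i k)))) ⟩
        E i i ∎
        where open ≡-Reasoning

      defect : Fin n → Vec n
      defect i = lin 1# (δ i) (- 1#) (E i)

      -- The right-hand side is 1 - `E i i`, left unsimplified so that `sum-linear` applies to it.
      ‖defect‖² : ∀ i → ‖ defect i ‖² ≡ 1# * 1# + - 1# * E i i
      ‖defect‖² i = trans
        (‖lin‖² 1# (δ i) (- 1#) (E i) (trans (sum-δ (δ i) i) (δ-refl i)) (sum-δ (E i) i) (‖E‖² i))
        (solve 1 (λ e →
          nat 1 :* nat 1 :* nat 1 :+ nat 2 :* (nat 1 :* (:- nat 1) :* e) :+ (:- nat 1) :* (:- nat 1) :* e :=
          nat 1 :* nat 1 :+ (:- nat 1) :* e) refl (E i i))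

      -- Exchanging the sums counts the unit vectors `f k`. Here it matters that there are as many
      -- of them as dimensions.
      trace-E : ∑[ i < n ] E i i ≡ ∑[ i < n ] 1#
      trace-E = trans (∑-comm {n} {n} _)
        (sum-cong-≗ {n} (λ k → trans (orthonormal k k) (δ-refl k)))

      total-defect : ∑[ i < n ] ‖ defect i ‖² ≡ 0#
      total-defect = begin
        ∑[ i < n ] ‖ defect i ‖²
          ≡⟨ sum-cong-≗ {n} ‖defect‖² ⟩
        ∑[ i < n ] (1# * 1# + - 1# * E i i)
          ≡⟨ sum-linear {n} 1# (λ _ → 1#) (- 1#) (λ i → E i i) ⟩
        1# * ∑[ i < n ] 1# + - 1# * ∑[ i < n ] E i i
          ≡⟨ cong (λ p → 1# * ∑[ i < n ] 1# + - 1# * p) trace-E ⟩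
        1# * ∑[ i < n ] 1# + - 1# * ∑[ i < n ] 1#
          ≡⟨ solve 1 (λ s → nat 1 :* s :+ (:- nat 1) :* s := nat 0) refl (∑[ i < n ] 1#) ⟩
        0# ∎
        where open ≡-Reasoning

    complete : ∀ i j → ∑[ k < n ] (f k i * f k j) ≡ δ i j
    complete i j = begin
      E i j               ≡⟨ solve 2 (λ d e → e := d :- (nat 1 :* d :+ (:- nat 1) :* e)) refl (δ i j) (E i j) ⟩
      δ i j - defect i j  ≡⟨ cong (λ z → δ i j - z) (‖‖²≡0 (defect i) defectᵢ≡0 j) ⟩
      δ i j - 0#          ≡⟨ solve 1 (λ d → d :- nat 0 := d) refl (δ i j) ⟩
      δ i j               ∎
      where
      open ≡-Reasoning
      defectᵢ≡0 : ‖ defect i ‖² ≡ 0#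
      defectᵢ≡0 = sum≡0⇒term≡0 (λ i → ‖‖²-nonNeg (defect i)) total-defect i

    parseval : ∀ x y → ⟨ x , y ⟩ ≡ ∑[ k < n ] (⟨ x , f k ⟩ * ⟨ y , f k ⟩)
    parseval x y = begin
      ∑[ i < n ] (x i * y i)
        ≡⟨ sum-cong-≗ {n} (λ i → cong (x i *_) (expand-y i)) ⟩
      ∑[ i < n ] (x i * ∑[ k < n ] (f k i * ⟨ y , f k ⟩))
        ≡⟨ sum-cong-≗ {n} (λ i → *-distribˡ-sum {n} (x i) _) ⟩
      ∑[ i < n ] ∑[ k < n ] (x i * (f k i * ⟨ y , f k ⟩))
        ≡⟨ ∑-comm {n} {n} _ ⟩
      ∑[ k < n ] ∑[ i < n ] (x i * (f k i * ⟨ y , f k ⟩))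
        ≡⟨ sum-cong-≗ {n} (λ k → trans
             (sum-cong-≗ {n} (λ i → sym (*-assoc (x i) (f k i) _)))
             (sym (*-distribʳ-sum {n} ⟨ y , f k ⟩ _))) ⟩
      ∑[ k < n ] (⟨ x , f k ⟩ * ⟨ y , f k ⟩) ∎
      where
      open ≡-Reasoning
      expand-y : ∀ i → y i ≡ ∑[ k < n ] (f k i * ⟨ y , f k ⟩)
      expand-y i = begin
        y i
          ≡⟨ sum-δ y i ⟨
        ∑[ j < n ] (δ i j * y j)
          ≡⟨ sum-cong-≗ {n} (λ j → trans (cong (_* y j) (sym (complete i j)))
               (*-distribʳ-sum {n} (y j) _)) ⟩
        ∑[ j < n ] ∑[ k < n ] (f k i * f k j * y j)
          ≡⟨ ∑-comm {n} {n} _ ⟩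
        ∑[ k < n ] ∑[ j < n ] (f k i * f k j * y j)
          ≡⟨ sum-cong-≗ {n} (λ k → trans
               (sum-cong-≗ {n} (λ j → solve 3 (λ a b y → a :* b :* y := a :* (y :* b)) refl
                 (f k i) (f k j) (y j)))
               (sym (*-distribˡ-sum {n} (f k i) _))) ⟩
        ∑[ k < n ] (f k i * ⟨ y , f k ⟩) ∎

  -- Rayleigh quotients in an eigenbasis.

  module Spectral {M : Matrix n n} (M-sym : Symmetric M) (S : Spectrum M) where

    open Spectrum S public renaming (eigenvector to f; eigenvalue to μ)
    open Completeness f orthonormal public

    ‖f‖² : ∀ k → ‖ f k ‖² ≡ 1#
    ‖f‖² k = trans (orthonormal k k) (δ-refl k)

    ⟨,Mf⟩ : ∀ x k → ⟨ x , M ⊠ᵛ f k ⟩ ≡ μ k * ⟨ x , f k ⟩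
    ⟨,Mf⟩ x k = trans
      (sum-cong-≗ {n} (λ i → trans (cong (x i *_) (eigen-equation k i))
        (solve 3 (λ x m f → x :* (m :* f) := m :* (x :* f)) refl (x i) (μ k) (f k i))))
      (sym (*-distribˡ-sum {n} (μ k) _))

    quadForm-f : ∀ k → quadForm M (f k) ≡ μ k
    quadForm-f k = trans (⟨,Mf⟩ (f k) k)
      (trans (cong (μ k *_) (‖f‖² k)) (trans (*-comm (μ k) 1#) (*-identityˡ (μ k))))

    ⟨Mx,f⟩ : ∀ x k → ⟨ M ⊠ᵛ x , f k ⟩ ≡ μ k * ⟨ x , f k ⟩
    ⟨Mx,f⟩ x k = trans (sym (self-adjoint M-sym x (f k))) (⟨,Mf⟩ x k)

    -- By Parseval both sides are sums over the eigenbasis. The hypothesis keeps the squared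
    -- coefficients, so that `c ≤ μ k` may fail wherever `x` is orthogonal to `f k`.
    quadForm-≥ : ∀ c x → (∀ k → c * (⟨ x , f k ⟩ * ⟨ x , f k ⟩) ≤ μ k * (⟨ x , f k ⟩ * ⟨ x , f k ⟩)) →
                 c * ‖ x ‖² ≤ quadForm M x
    quadForm-≥ c x p = ≤-subst₂
      (trans (sym (*-distribˡ-sum {n} c _)) (cong (c *_) (sym (parseval x x))))
      (trans
        (sum-cong-≗ {n} (λ k → trans
          (solve 2 (λ m y → m :* (y :* y) := y :* (m :* y)) refl (μ k) ⟨ x , f k ⟩)
          (cong (⟨ x , f k ⟩ *_) (sym (⟨Mx,f⟩ x k)))))
        (sym (parseval x (M ⊠ᵛ x))))
      (sum-mono p)

    first-≤ : ∀ {i} → suc (toℕ i) ≡ 1 → ∀ x → μ i * ‖ x ‖² ≤ quadForm M x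
    first-≤ {i} i≡1 x = quadForm-≥ (μ i) x (λ k → *-monoʳ (0≤x² ⟨ x , f k ⟩) (nondecreasing (i≤k k)))
      where
      i≤k : ∀ k → i Fin.≤ k
      i≤k k = subst (ℕ._≤ toℕ k) (cong ℕ.pred (sym i≡1)) ℕ.z≤n

    module SecondPositive {j} (j≡2 : suc (toℕ j) ≡ 2) (0≤μⱼ : 0# ≤ μ j) (μⱼ≢0 : μ j ≢ 0#) where

      later⊎first : ∀ k → μ j ≤ μ k ⊎ toℕ k ≡ 0
      later⊎first k with toℕ k in eq
      ... | zero   = inj₂ refl
      ... | suc k′ = inj₁ (nondecreasing (subst₂ ℕ._≤_ (sym (cong ℕ.pred j≡2)) (sym eq) (ℕ.s≤s ℕ.z≤n)))

      Null : Vec n → Set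
      Null x = ∀ i → (M ⊠ᵛ x) i ≡ 0#

      null-⊥ : ∀ {x} → Null x → ∀ k → μ j ≤ μ k → ⟨ x , f k ⟩ ≡ 0#
      null-⊥ {x} x-null k μⱼ≤μₖ =
        [ (λ μₖ≡0 → contradiction (≤-antisym (≤-substʳ μₖ≡0 μⱼ≤μₖ) 0≤μⱼ) μⱼ≢0)
        , (λ xₖ≡0 → xₖ≡0) ]′ (x*y≡0⇒x≡0⊎y≡0 μₖxₖ≡0)
        where
        μₖxₖ≡0 : μ k * ⟨ x , f k ⟩ ≡ 0#
        μₖxₖ≡0 = trans (sym (⟨Mx,f⟩ x k)) (trans
          (sum-cong-≗ {n} (λ i → trans (cong (_* f k i) (x-null i)) (zeroˡ (f k i))))
          (sum-replicate-zero n))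

      -- Only the first eigenvalue can vanish, so x is a multiple of f k.
      null-parseval : ∀ {x} → Null x → ∀ y k → toℕ k ≡ 0 → ⟨ y , x ⟩ ≡ ⟨ y , f k ⟩ * ⟨ x , f k ⟩
      null-parseval {x} x-null y k k≡0 = trans (parseval y x)
        (trans (sum-cong-≗ {n} term) (sum-δ (λ l → ⟨ y , f l ⟩ * ⟨ x , f l ⟩) k))
        where
        term : ∀ l → ⟨ y , f l ⟩ * ⟨ x , f l ⟩ ≡ δ k l * (⟨ y , f l ⟩ * ⟨ x , f l ⟩)
        term l =
          [ (λ μⱼ≤μₗ → vanishing (trans (cong (⟨ y , f l ⟩ *_) (null-⊥ x-null l μⱼ≤μₗ)) (zeroʳ ⟨ y , f l ⟩)))
          , (λ l≡0 → sym (trans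
              (cong (_* (⟨ y , f l ⟩ * ⟨ x , f l ⟩))
                (trans (cong (λ i → δ i l) (Fin.toℕ-injective (trans k≡0 (sym l≡0)))) (δ-refl l)))
              (*-identityˡ _))) ]′ (later⊎first l)
          where
          vanishing : ∀ {t} → t ≡ 0# → t ≡ δ k l * t
          vanishing refl = sym (zeroʳ (δ k l))

      -- A nonzero null vector is a nonzero multiple of the bottom eigenvector and can stand in for
      -- it. An explicit null vector thus replaces the unknown one of the given spectrum.
      null-orthogonal : ∀ {x} → Null x → ‖ x ‖² ≢ 0# → ∀ y → ⟨ y , x ⟩ ≡ 0# →
                        ∀ k → toℕ k ≡ 0 → ⟨ y , f k ⟩ ≡ 0#
      null-orthogonal {x} x-null x≢0 y yx≡0 k k≡0 =
        [ (λ yₖ≡0 → yₖ≡0)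
        , (λ xₖ≡0 → contradiction
            (trans (null-parseval x-null x k k≡0) (trans (cong (_* ⟨ x , f k ⟩) xₖ≡0) (zeroˡ _))) x≢0)
        ]′ (x*y≡0⇒x≡0⊎y≡0 (trans (sym (null-parseval x-null y k k≡0)) yx≡0))

      -- The bottom coefficient of `y` vanishes, and every other eigenvalue is at least `μ j`.
      ⊥null-≤ : ∀ {x} → Null x → ‖ x ‖² ≢ 0# → ∀ y → ⟨ y , x ⟩ ≡ 0# → μ j * ‖ y ‖² ≤ quadForm M y
      ⊥null-≤ {x} x-null x≢0 y yx≡0 = quadForm-≥ (μ j) y (λ k →
        [ *-monoʳ (0≤x² ⟨ y , f k ⟩)
        , (λ k≡0 → vanishing k (null-orthogonal x-null x≢0 y yx≡0 k k≡0)) ]′ (later⊎first k))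
        where
        vanishing : ∀ k {t} → t ≡ 0# → μ j * (t * t) ≤ μ k * (t * t)
        vanishing k refl = ≤-reflexive (solve 2 (λ a b → a :* (nat 0 :* nat 0) := b :* (nat 0 :* nat 0)) refl (μ j) (μ k))

-- Lossy Laplacians, their energies and diagonal scalings.

module Graphs (reals : RealNumbers) where

  open OverReals reals
  open OrderedField
  open RealAlgebra reals
  open LinearAlgebra reals
  open import Algebra.Properties.Semiring.Sum semiring
    using (sum-cong-≗; ∑-comm; *-distribˡ-sum; *-distribʳ-sum)

  √-square : ∀ {x} → 0# ≤ x → √ x * √ x ≡ x
  √-square {x} 0≤x with 0# ≤? x
  ... | yes p = proj₂ (proj₂ (sqrt-exists x p))
  ... | no ¬p = contradiction 0≤x ¬p

  0⁻¹≡0 : 0# ⁻¹ ≡ 0#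
  0⁻¹≡0 with 0# ≟ 0#
  ... | yes _   = refl
  ... | no  0≢0 = contradiction refl 0≢0

  √⁻¹-zero : ∀ {x} → x ≡ 0# → (√ x) ⁻¹ ≡ 0#
  √⁻¹-zero refl = trans (cong _⁻¹ (x²≡0⇒x≡0 (√-square ≤-refl))) 0⁻¹≡0

  √*√⁻¹ : ∀ {x} → 0# ≤ x → x ≢ 0# → √ x * (√ x) ⁻¹ ≡ 1#
  √*√⁻¹ {x} 0≤x x≢0 = *-inverseʳ
    (λ √x≡0 → x≢0 (trans (sym (√-square 0≤x)) (trans (cong (_* √ x) √x≡0) (zeroˡ (√ x)))))

  x*√⁻¹² : ∀ {x} → 0# ≤ x → x ≢ 0# → x * ((√ x) ⁻¹ * (√ x) ⁻¹) ≡ 1#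
  x*√⁻¹² {x} 0≤x x≢0 = begin
    x * (t * t)           ≡⟨ cong (_* (t * t)) (√-square 0≤x) ⟨
    √ x * √ x * (t * t)   ≡⟨ solve 2 (λ s t → s :* s :* (t :* t) := (s :* t) :* (s :* t)) refl (√ x) t ⟩
    √ x * t * (√ x * t)   ≡⟨ cong₂ _*_ (√*√⁻¹ 0≤x x≢0) (√*√⁻¹ 0≤x x≢0) ⟩
    1# * 1#               ≡⟨ *-identityˡ 1# ⟩
    1#                    ∎
    where
    open ≡-Reasoning
    t = (√ x) ⁻¹

  -- Equality fails only at 0, where the left side is 0. The inequality suffices for upper bounds on
  -- scaled Laplacians, which therefore tolerate isolated vertices.
  x*√⁻¹²-≤ : ∀ {x} → 0# ≤ x → x * ((√ x) ⁻¹ * (√ x) ⁻¹) ≤ 1#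
  x*√⁻¹²-≤ {x} 0≤x = helper (x ≟ 0#)
    where
    helper : Dec (x ≡ 0#) → x * ((√ x) ⁻¹ * (√ x) ⁻¹) ≤ 1#
    helper (yes x≡0) = ≤-substˡ (sym (trans (cong (_* ((√ x) ⁻¹ * (√ x) ⁻¹)) x≡0) (zeroˡ _))) 0≤1
    helper (no  x≢0) = ≤-reflexive (x*√⁻¹² 0≤x x≢0)

  ⊠-diag : ∀ {m n} (M : Matrix m n) t i j → (M ⊠ diag t) i j ≡ M i j * t j
  ⊠-diag {n = n} M t i j = trans
    (sum-cong-≗ {n} (λ k → trans
      (solve 3 (λ m t d → m :* (t :* d) := d :* (m :* t)) refl (M i k) (t k) (δ k j))
      (cong (_* (M i k * t k)) (δ-sym k j))))
    (sum-δ (λ k → M i k * t k) j)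

  diag-⊠ : ∀ {m n} t (M : Matrix m n) i j → (diag t ⊠ M) i j ≡ t i * M i j
  diag-⊠ {m} t M i j = trans
    (sum-cong-≗ {m} (λ k → solve 3 (λ t d m → t :* d :* m := d :* (t :* m)) refl (t i) (δ i k) (M k j)))
    (sum-δ (λ k → t i * M k j) i)

  module LossyFlow {n} (G : LossyFlowGraph n) where

    open LossyFlowGraph G public

    flow : Vec n → Vec m
    flow x e = x (b e) - η e * x (a e)

    B : Matrix m n
    B = incidence G

    incidence-⊠ᵛ : ∀ x → B ⊠ᵛ x ≗ flow x
    incidence-⊠ᵛ x e = begin
      ∑[ i < n ] ((δ (b e) i - η e * δ (a e) i) * x i)
        ≡⟨ sum-cong-≗ {n} (λ i → solve 4 (λ p h q x →
             (p :- h :* q) :* x := nat 1 :* (p :* x) :+ (:- h) :* (q :* x)) refl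
             (δ (b e) i) (η e) (δ (a e) i) (x i)) ⟩
      ∑[ i < n ] (1# * (δ (b e) i * x i) + - η e * (δ (a e) i * x i))
        ≡⟨ sum-linear {n} 1# _ (- η e) _ ⟩
      1# * ∑[ i < n ] (δ (b e) i * x i) + - η e * ∑[ i < n ] (δ (a e) i * x i)
        ≡⟨ cong₂ (λ p q → 1# * p + - η e * q) (sum-δ x (b e)) (sum-δ x (a e)) ⟩
      1# * x (b e) + - η e * x (a e)
        ≡⟨ solve 3 (λ p h q → nat 1 :* p :+ (:- h) :* q := p :- h :* q) refl (x (b e)) (η e) (x (a e)) ⟩
      flow x e ∎
      where open ≡-Reasoning

    laplacian-entry : ∀ i j → laplacian G i j ≡ ∑[ e < m ] (w e * (B e i * B e j))
    laplacian-entry i j = sum-cong-≗ {m} (λ e → trans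
      (cong (_* B e j) (⊠-diag (B ᵀ) w i e))
      (solve 3 (λ p w q → p :* w :* q := w :* (p :* q)) refl (B e i) (w e) (B e j)))

    laplacian-sym : Symmetric (laplacian G)
    laplacian-sym i j = trans (laplacian-entry i j) (trans
      (sum-cong-≗ {m} (λ e → cong (w e *_) (*-comm (B e i) (B e j))))
      (sym (laplacian-entry j i)))

    laplacian-⊠ᵛ : ∀ x i → (laplacian G ⊠ᵛ x) i ≡ ∑[ e < m ] (w e * (B e i * flow x e))
    laplacian-⊠ᵛ x i = begin
      ∑[ j < n ] (laplacian G i j * x j)
        ≡⟨ sum-cong-≗ {n} (λ j → trans (cong (_* x j) (laplacian-entry i j)) (*-distribʳ-sum {m} (x j) _)) ⟩
      ∑[ j < n ] ∑[ e < m ] (w e * (B e i * B e j) * x j)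
        ≡⟨ ∑-comm {n} {m} _ ⟩
      ∑[ e < m ] ∑[ j < n ] (w e * (B e i * B e j) * x j)
        ≡⟨ sum-cong-≗ {m} (λ e → trans
             (sum-cong-≗ {n} (λ j → solve 4 (λ w p q x → w :* (p :* q) :* x := w :* p :* (q :* x)) refl
               (w e) (B e i) (B e j) (x j)))
             (trans (sym (*-distribˡ-sum {n} (w e * B e i) _))
               (trans (cong (w e * B e i *_) (incidence-⊠ᵛ x e)) (*-assoc _ _ _)))) ⟩
      ∑[ e < m ] (w e * (B e i * flow x e)) ∎
      where open ≡-Reasoning

    energy : Vec n → ℝ
    energy x = ∑[ e < m ] (w e * (flow x e * flow x e))

    quadForm-laplacian : ∀ x → quadForm (laplacian G) x ≡ energy x
    quadForm-laplacian x = begin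
      ∑[ i < n ] (x i * (laplacian G ⊠ᵛ x) i)
        ≡⟨ sum-cong-≗ {n} (λ i → trans (cong (x i *_) (laplacian-⊠ᵛ x i)) (*-distribˡ-sum {m} (x i) _)) ⟩
      ∑[ i < n ] ∑[ e < m ] (x i * (w e * (B e i * flow x e)))
        ≡⟨ ∑-comm {n} {m} _ ⟩
      ∑[ e < m ] ∑[ i < n ] (x i * (w e * (B e i * flow x e)))
        ≡⟨ sum-cong-≗ {m} (λ e → trans
             (sum-cong-≗ {n} (λ i → solve 4 (λ x w p f → x :* (w :* (p :* f)) := w :* f :* (p :* x)) refl
               (x i) (w e) (B e i) (flow x e)))
             (trans (sym (*-distribˡ-sum {n} (w e * flow x e) _))
               (trans (cong (w e * flow x e *_) (incidence-⊠ᵛ x e)) (*-assoc _ _ _)))) ⟩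
      energy x ∎
      where open ≡-Reasoning

    -- Tested with `δ i` this gives the degree of a single vertex; tested with the squares of a
    -- potential it makes weighted norms comparable with energies, edge by edge.
    degree-sum : ∀ (x : Vec n) → ∑[ i < n ] (degree G i * x i) ≡
                       ∑[ e < m ] (w e * (x (b e) + η e * η e * x (a e)))
    degree-sum x = begin
      ∑[ i < n ] (degree G i * x i)
        ≡⟨ sum-cong-≗ {n} (λ i → trans (cong (_* x i) (laplacian-entry i i)) (*-distribʳ-sum {m} (x i) _)) ⟩
      ∑[ i < n ] ∑[ e < m ] (w e * (B e i * B e i) * x i)
        ≡⟨ ∑-comm {n} {m} _ ⟩
      ∑[ e < m ] ∑[ i < n ] (w e * (B e i * B e i) * x i)
        ≡⟨ sum-cong-≗ {m} (λ e → trans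
             (sum-cong-≗ {n} (λ i → solve 3 (λ w p x → w :* (p :* p) :* x := w :* (p :* (p :* x))) refl
               (w e) (B e i) (x i)))
             (trans (sym (*-distribˡ-sum {n} (w e) _)) (cong (w e *_) (row e)))) ⟩
      ∑[ e < m ] (w e * (x (b e) + η e * η e * x (a e))) ∎
      where
      open ≡-Reasoning
      B-b : ∀ e → B e (b e) ≡ 1#
      B-b e = trans (cong₂ (λ p q → p - η e * q) (δ-refl (b e)) (δ-≢ (a≢b e)))
        (solve 1 (λ h → nat 1 :- h :* nat 0 := nat 1) refl (η e))
      B-a : ∀ e → B e (a e) ≡ - η e
      B-a e = trans (cong₂ (λ p q → p - η e * q) (δ-≢ (a≢b e ∘ sym)) (δ-refl (a e)))
        (solve 1 (λ h → nat 0 :- h :* nat 1 := :- h) refl (η e))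
      -- Applying the row to `B e i * x i` squares its own entries; the endpoints are distinct, so
      -- there is no mixed term.
      row : ∀ e → ⟨ B e , (λ i → B e i * x i) ⟩ ≡ x (b e) + η e * η e * x (a e)
      row e = trans (incidence-⊠ᵛ (λ i → B e i * x i) e) (trans
        (cong₂ (λ p q → p * x (b e) - η e * (q * x (a e))) (B-b e) (B-a e))
        (solve 3 (λ h p q → nat 1 :* p :- h :* ((:- h) :* q) := p :+ h :* h :* q) refl (η e) (x (b e)) (x (a e))))

    degree≡ : ∀ i → degree G i ≡ ∑[ e < m ] (w e * (δ i (b e) + η e * η e * δ i (a e)))
    degree≡ i = trans (sym (sum-δ (degree G) i)) (trans
      (sum-cong-≗ {n} (λ j → *-comm (δ i j) (degree G j))) (degree-sum (δ i)))

    δ-nonNeg : ∀ (i j : Fin n) → 0# ≤ δ i j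
    δ-nonNeg i j with i Fin.≟ j
    ... | yes _ = 0≤1
    ... | no  _ = ≤-refl

    degree-term-nonNeg : ∀ i e → 0# ≤ w e * (δ i (b e) + η e * η e * δ i (a e))
    degree-term-nonNeg i e = *-nonNeg (0≤w e)
      (+-nonNeg (δ-nonNeg i (b e)) (*-nonNeg (0≤x² (η e)) (δ-nonNeg i (a e))))

    degree-nonNeg : ∀ i → 0# ≤ degree G i
    degree-nonNeg i = ≤-substʳ (sym (degree≡ i)) (sum-nonNeg (degree-term-nonNeg i))

    1≤η² : ∀ e → 1# ≤ η e * η e
    1≤η² e = ≤-trans (1≤η e)
      (≤-substˡ (*-identityˡ (η e)) (*-monoʳ (≤-trans 0≤1 (1≤η e)) (1≤η e)))

    w≤degree-a : ∀ e → w e ≤ degree G (a e)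
    w≤degree-a e = ≤-trans
      (≤-subst₂ (trans (*-comm (w e) 1#) (*-identityˡ (w e)))
        (cong (w e *_) (sym (trans
          (cong₂ (λ p q → p + η e * η e * q) (δ-≢ (a≢b e)) (δ-refl (a e)))
          (solve 1 (λ h → nat 0 :+ h :* h :* nat 1 := h :* h) refl (η e)))))
        (*-monoˡ (0≤w e) (1≤η² e)))
      (≤-substʳ (sym (degree≡ (a e))) (term≤sum (degree-term-nonNeg (a e)) e))

    w≤degree-b : ∀ e → w e ≤ degree G (b e)
    w≤degree-b e = ≤-trans
      (≤-reflexive (sym (trans
        (cong₂ (λ p q → w e * (p + η e * η e * q)) (δ-refl (b e)) (δ-≢ (a≢b e ∘ sym)))
        (solve 2 (λ w h → w :* (nat 1 :+ h :* h :* nat 0) := w) refl (w e) (η e)))))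
      (≤-substʳ (sym (degree≡ (b e))) (term≤sum (degree-term-nonNeg (b e)) e))

    energy-nonNeg : ∀ x → 0# ≤ energy x
    energy-nonNeg x = sum-nonNeg (λ e → *-nonNeg (0≤w e) (0≤x² (flow x e)))

    -- The parallelogram identity on every edge: the slack is the energy with the sign of `η e`
    -- reversed.
    energy≤2degree : ∀ x → energy x ≤ num 2 * ∑[ i < n ] (degree G i * (x i * x i))
    energy≤2degree x = ≤-substʳ
      (trans (sym (*-distribˡ-sum {m} (num 2) _))
        (cong (num 2 *_) (sym (degree-sum (λ i → x i * x i)))))
      (sum-mono (λ e → ≤-by _ (*-nonNeg (0≤w e) (0≤x² (x (b e) + η e * x (a e))))
        (solve 4 (λ w p h q →
          nat 2 :* (w :* (p :* p :+ h :* h :* (q :* q))) :=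
          w :* ((p :- h :* q) :* (p :- h :* q)) :+ w :* ((p :+ h :* q) :* (p :+ h :* q)))
          refl (w e) (x (b e)) (η e) (x (a e)))))

    module Scaled (d : Vec n) where

      t : Vec n
      t i = (√ d i) ⁻¹

      potential : Vec n → Vec n
      potential x i = t i * x i

      scaled-entry : ∀ i j → scaledLaplacian d G i j ≡ t i * laplacian G i j * t j
      scaled-entry i j = trans (⊠-diag (diag t ⊠ laplacian G) t i j)
        (cong (_* t j) (diag-⊠ t (laplacian G) i j))

      scaled-sym : Symmetric (scaledLaplacian d G)
      scaled-sym i j = begin
        scaledLaplacian d G i j       ≡⟨ scaled-entry i j ⟩
        t i * laplacian G i j * t j   ≡⟨ cong (λ l → t i * l * t j) (laplacian-sym i j) ⟩
        t i * laplacian G j i * t j   ≡⟨ solve 3 (λ p l q → p :* l :* q := q :* l :* p) refl (t i) (laplacian G j i) (t j) ⟩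
        t j * laplacian G j i * t i   ≡⟨ scaled-entry j i ⟨
        scaledLaplacian d G j i       ∎
        where open ≡-Reasoning

      scaled-⊠ᵛ : ∀ x i → (scaledLaplacian d G ⊠ᵛ x) i ≡ t i * (laplacian G ⊠ᵛ potential x) i
      scaled-⊠ᵛ x i = trans
        (sum-cong-≗ {n} (λ j → trans (cong (_* x j) (scaled-entry i j))
          (solve 4 (λ p l q x → p :* l :* q :* x := p :* (l :* (q :* x))) refl
            (t i) (laplacian G i j) (t j) (x j))))
        (sym (*-distribˡ-sum {n} (t i) _))

      quadForm-scaled : ∀ x → quadForm (scaledLaplacian d G) x ≡ energy (potential x)
      quadForm-scaled x = trans
        (sum-cong-≗ {n} (λ i → trans (cong (x i *_) (scaled-⊠ᵛ x i))
          (solve 3 (λ x t l → x :* (t :* l) := t :* x :* l) refl (x i) (t i) _)))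
        (quadForm-laplacian (potential x))

      quadForm-scaled-nonNeg : ∀ x → 0# ≤ quadForm (scaledLaplacian d G) x
      quadForm-scaled-nonNeg x = ≤-substʳ (sym (quadForm-scaled x)) (energy-nonNeg (potential x))

      quadForm-scaled-≤2 : (∀ i → 0# ≤ d i) → degree G ≤ᵛ d →
                           ∀ x → quadForm (scaledLaplacian d G) x ≤ num 2 * ‖ x ‖²
      quadForm-scaled-≤2 0≤d degree≤d x = ≤-substˡ (sym (quadForm-scaled x))
        (≤-trans (energy≤2degree (potential x)) (*-monoˡ (num-nonNeg 2) (sum-mono term)))
        where
        term : ∀ i → degree G i * (t i * x i * (t i * x i)) ≤ x i * x i
        term i = ≤-trans (*-monoʳ (0≤x² (t i * x i)) (degree≤d i))
          (≤-subst₂ (solve 3 (λ d t x → d :* (t :* t) :* (x :* x) := d :* (t :* x :* (t :* x))) refl (d i) (t i) (x i))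
            (*-identityˡ (x i * x i))
            (*-monoʳ (0≤x² (x i)) (x*√⁻¹²-≤ (0≤d i))))

-- Moving a spectral gap to the complement of an approximate minimizer.

module Deflation (reals : RealNumbers) where

  open OverReals reals
  open OrderedField
  open RealAlgebra reals
  open LinearAlgebra reals

  -- The gap passes from the hyperplane ⊥ s to the hyperplane ⊥ f because, for every h ⊥ f,
  -- the plane of f and h meets ⊥ s, and f has the smallest Rayleigh quotient in it.
  module LowestEigenvector {n} {M : Matrix n n} (M-sym : Symmetric M)
    (f : Vec n) {λ₁ : ℝ} (‖f‖²≡1 : ‖ f ‖² ≡ 1#) (⟨,Mf⟩ : ∀ x → ⟨ x , M ⊠ᵛ f ⟩ ≡ λ₁ * ⟨ x , f ⟩)
    (lowest : ∀ x → λ₁ * ‖ x ‖² ≤ quadForm M x) (s : Vec n) {μ K : ℝ} (0≤K : 0# ≤ K)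
    (gap : ∀ y → ⟨ y , s ⟩ ≡ 0# → μ * ‖ y ‖² ≤ K * quadForm M y) where

    quadForm-f≡λ₁ : quadForm M f ≡ λ₁
    quadForm-f≡λ₁ = trans (⟨,Mf⟩ f) (trans (cong (λ₁ *_) ‖f‖²≡1) (trans (*-comm λ₁ 1#) (*-identityˡ λ₁)))

    gap-⊥f : ∀ h → ⟨ h , f ⟩ ≡ 0# → μ * ‖ h ‖² ≤ K * quadForm M h
    gap-⊥f h hf≡0 = helper (a ≟ 0#)
      where
      a b k H : ℝ
      a = ⟨ h , s ⟩
      b = - ⟨ f , s ⟩
      k = ‖ h ‖²
      H = quadForm M h

      y : Vec n
      y = lin a f b h

      y⊥s : ⟨ y , s ⟩ ≡ 0#
      y⊥s = trans (⟨⟩-linˡ a f b h s)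
        (solve 2 (λ p q → p :* q :+ (:- q) :* p := nat 0) refl a ⟨ f , s ⟩)

      fMh≡0 : ⟨ f , M ⊠ᵛ h ⟩ ≡ 0#
      fMh≡0 = trans (self-adjoint M-sym f h) (trans (⟨⟩-comm (M ⊠ᵛ f) h)
        (trans (⟨,Mf⟩ h) (trans (cong (λ₁ *_) hf≡0) (zeroʳ λ₁))))

      ‖y‖² : ‖ y ‖² ≡ a * a * 1# + num 2 * (a * b * 0#) + b * b * k
      ‖y‖² = ‖lin‖² a f b h ‖f‖²≡1 (trans (⟨⟩-comm f h) hf≡0) refl

      yMy : quadForm M y ≡ a * a * λ₁ + num 2 * (a * b * 0#) + b * b * H
      yMy = trans (quadForm-lin M-sym a f b h)
        (cong₂ (λ p q → a * a * p + num 2 * (a * b * q) + b * b * H) quadForm-f≡λ₁ fMh≡0)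

      T : ℝ
      T = a * a + b * b * k

      0≤b²k : 0# ≤ b * b * k
      0≤b²k = *-nonNeg (0≤x² b) (‖‖²-nonNeg h)

      0≤T : 0# ≤ T
      0≤T = +-nonNeg (0≤x² a) 0≤b²k

      -- `T` is `‖ y ‖²`. The gap at `y`, weighted by `k`, and the excess `H - λ₁ * k`, weighted by
      -- `K * (a * a)`, add up to exactly `T` times the claim.
      scaled-gap : T * (μ * k) ≤ T * (K * H)
      scaled-gap = ≤-by
        ((K * quadForm M y - μ * ‖ y ‖²) * k + K * (a * a) * (H - λ₁ * k))
        (+-nonNeg (*-nonNeg (0≤- (gap y y⊥s)) (‖‖²-nonNeg h))
          (*-nonNeg (*-nonNeg 0≤K (0≤x² a)) (0≤- (lowest h))))
        (trans (solve 7 (λ a b k H K m l →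
            (a :* a :+ b :* b :* k) :* (K :* H) :=
            (a :* a :+ b :* b :* k) :* (m :* k) :+
            ((K :* (a :* a :* l :+ nat 2 :* (a :* b :* nat 0) :+ b :* b :* H) :-
              m :* (a :* a :* nat 1 :+ nat 2 :* (a :* b :* nat 0) :+ b :* b :* k)) :* k :+
             K :* (a :* a) :* (H :- l :* k))) refl a b k H K μ λ₁)
          (cong₂ (λ p q → T * (μ * k) + ((K * p - μ * q) * k + K * (a * a) * (H - λ₁ * k)))
            (sym yMy) (sym ‖y‖²)))

      helper : Dec (a ≡ 0#) → μ * k ≤ K * H
      -- If `f` is orthogonal to `s` as well, then `y` and `T` vanish and `scaled-gap` is void; but
      -- here `h` itself lies in the hyperplane.
      helper (yes a≡0) = gap h a≡0
      helper (no  a≢0) = *-cancelˡ 0≤T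
        (λ T≡0 → a≢0 (x²≡0⇒x≡0 (≤-antisym (≤-substʳ T≡0 (≤-by _ 0≤b²k refl)) (0≤x² a)))) scaled-gap

    module _ (x : Vec n) where

      deflate : Vec n
      deflate = lin 1# x (- ⟨ x , f ⟩) f

      deflate-⊥f : ⟨ deflate , f ⟩ ≡ 0#
      deflate-⊥f = trans (⟨⟩-linˡ 1# x (- ⟨ x , f ⟩) f f)
        (trans (cong (λ p → 1# * ⟨ x , f ⟩ + - ⟨ x , f ⟩ * p) ‖f‖²≡1)
          (solve 1 (λ q → nat 1 :* q :+ (:- q) :* nat 1 := nat 0) refl ⟨ x , f ⟩))

      ‖deflate‖² : ‖ deflate ‖² ≡ ‖ x ‖² - ⟨ x , f ⟩ * ⟨ x , f ⟩
      ‖deflate‖² = trans (‖lin‖² 1# x (- ⟨ x , f ⟩) f refl refl ‖f‖²≡1)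
        (solve 2 (λ q n →
          nat 1 :* nat 1 :* n :+ nat 2 :* (nat 1 :* (:- q) :* q) :+ (:- q) :* (:- q) :* nat 1 :=
          n :- q :* q) refl ⟨ x , f ⟩ ‖ x ‖²)

      quadForm-deflate : quadForm M deflate ≡ quadForm M x - ⟨ x , f ⟩ * ⟨ x , f ⟩ * λ₁
      quadForm-deflate = trans (quadForm-lin M-sym 1# x (- ⟨ x , f ⟩) f)
        (trans (cong₂ (λ p r → 1# * 1# * quadForm M x + num 2 * (1# * - ⟨ x , f ⟩ * p) +
                 - ⟨ x , f ⟩ * - ⟨ x , f ⟩ * r) (⟨,Mf⟩ x) quadForm-f≡λ₁)
          (solve 3 (λ q n l →
            nat 1 :* nat 1 :* n :+ nat 2 :* (nat 1 :* (:- q) :* (l :* q)) :+ (:- q) :* (:- q) :* l :=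
            n :- q :* q :* l) refl ⟨ x , f ⟩ (quadForm M x) λ₁))

      -- As `f` is an eigenvector, removing the component along it leaves no cross term in the norm
      -- or in the form.
      gap-deflate : μ * (‖ x ‖² - ⟨ x , f ⟩ * ⟨ x , f ⟩) ≤
                    K * (quadForm M x - ⟨ x , f ⟩ * ⟨ x , f ⟩ * λ₁)
      gap-deflate = ≤-subst₂ (cong (μ *_) ‖deflate‖²) (cong (K *_) quadForm-deflate)
        (gap-⊥f deflate deflate-⊥f)

    -- With q = ⟨ x , f ⟩ and p = ⟨ v , f ⟩, the distance from x to the line of v is at
    -- most that from x to q p v; the cross term is absorbed by the square of
    -- c (x - q f) + q p (v - p f).
    module ApproximateMinimizer (v : Vec n) (v-unit : IsUnit v) {c : ℝ} (1≤c : 1# ≤ c) (0≤λ₁ : 0# ≤ λ₁)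
      (0≤μ : 0# ≤ μ) (approximate : quadForm M v ≤ c * λ₁) (x : Vec n) where

      private
        p q α X N g h : ℝ
        p = ⟨ v , f ⟩
        q = ⟨ x , f ⟩
        α = ⟨ x , v ⟩
        X = quadForm M x
        N = ‖ x ‖²
        g = 1# - p * p
        h = N - q * q

        0≤c : 0# ≤ c
        0≤c = ≤-trans 0≤1 1≤c

        0≤1+c : 0# ≤ 1# + c
        0≤1+c = +-nonNeg 0≤1 0≤c

        -- `g` is the squared norm of the part of `v` orthogonal to `f`. The energy of that part is
        -- at most the energy of `v`, hence at most `c * λ₁`, and the gap makes it short.
        μg≤ : μ * g ≤ K * (c * λ₁)
        μg≤ = ≤-trans
          (≤-substˡ (cong (λ r → μ * (r - p * p)) v-unit) (gap-deflate v))
          (*-monoˡ 0≤K (≤-trans (≤-by _ (*-nonNeg (0≤x² p) 0≤λ₁)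
            (solve 2 (λ ℓ r → ℓ := ℓ :- r :+ r) refl (quadForm M v) (p * p * λ₁))) approximate))

        ⟨deflate,deflate⟩ : ⟨ deflate x , deflate v ⟩ ≡ α - p * q
        ⟨deflate,deflate⟩ = trans (⟨⟩-linʳ (deflate x) 1# v (- p) f)
          (trans (cong₂ (λ r s → 1# * r + - p * s)
              (trans (⟨⟩-linˡ 1# x (- q) f v) (cong (λ r → 1# * α + - q * r) (⟨⟩-comm f v)))
              (deflate-⊥f x))
            (solve 3 (λ a p q →
              nat 1 :* (nat 1 :* a :+ (:- q) :* p) :+ (:- p) :* nat 0 := a :- p :* q) refl α p q))

        cross : 0# ≤ c * c * h + num 2 * (c * (q * p) * (α - p * q)) + q * p * (q * p) * g
        cross = ≤-substʳ
          (‖lin‖² c (deflate x) (q * p) (deflate v) (‖deflate‖² x) ⟨deflate,deflate⟩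
            (trans (‖deflate‖² v) (cong (_- p * p) v-unit)))
          (‖‖²-nonNeg (lin c (deflate x) (q * p) (deflate v)))

        -- Young's inequality with weight `c` for x - q p v = (x - q f) + q (f - p v), whose two
        -- parts have squared norms `h` and `q * q * g`. The term with `α - q * p` accounts for q p
        -- v not being the nearest point on the line.
        distance : c * (N - α * α) ≤ (1# + c) * (q * q * g + c * h)
        distance = ≤-by
          (c * ((α - q * p) * (α - q * p)) +
            (c * c * h + num 2 * (c * (q * p) * (α - p * q)) + q * p * (q * p) * g) +
            q * g * (q * g))
          (+-nonNeg (+-nonNeg (*-nonNeg 0≤c (0≤x² (α - q * p))) cross) (0≤x² (q * g)))
          (solve 5 (λ c n a p q →
            (nat 1 :+ c) :* (q :* q :* (nat 1 :- p :* p) :+ c :* (n :- q :* q)) :=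
            c :* (n :- a :* a) :+
            (c :* ((a :- q :* p) :* (a :- q :* p)) :+
             (c :* c :* (n :- q :* q) :+ nat 2 :* (c :* (q :* p) :* (a :- p :* q)) :+
              q :* p :* (q :* p) :* (nat 1 :- p :* p)) :+
             q :* (nat 1 :- p :* p) :* (q :* (nat 1 :- p :* p)))) refl c N α p q)

      -- The weight in `distance` is chosen for this sum: the `c * λ₁` in the bound for `v` cancels
      -- the `- q * q * λ₁` in `c` times the bound for `x`, so only `X` remains.
      distance-≤ : μ * (N - α * α) ≤ K * (1# + c) * X
      distance-≤ = *-cancelˡ 0≤c (1≤⇒≢0 1≤c) (≤-by
        (μ * ((1# + c) * (q * q * g + c * h) - c * (N - α * α)) +
          (1# + c) * (q * q * (K * (c * λ₁) - μ * g) + c * (K * (X - q * q * λ₁) - μ * h)))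
        (+-nonNeg (*-nonNeg 0≤μ (0≤- distance))
          (*-nonNeg 0≤1+c (+-nonNeg (*-nonNeg (0≤x² q) (0≤- μg≤))
            (*-nonNeg 0≤c (0≤- (gap-deflate x))))))
        (solve 9 (λ c m K l X h g q u →
          c :* (K :* (nat 1 :+ c) :* X) :=
          c :* (m :* u) :+
          (m :* ((nat 1 :+ c) :* (q :* q :* g :+ c :* h) :- c :* u) :+
           (nat 1 :+ c) :* (q :* q :* (K :* (c :* l) :- m :* g) :+
             c :* (K :* (X :- q :* q :* l) :- m :* h))))
          refl c μ K λ₁ X h g q (N - α * α)))

-- The weighted Poincaré inequality of the smoothed graph.

module SpectralGap (reals : RealNumbers) where

  open OverReals reals
  open OrderedField
  open RealAlgebra reals
  open LinearAlgebra reals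
  open Graphs reals
  open import Algebra.Properties.Semiring.Sum semiring
    using (sum-cong-≗; *-distribˡ-sum; sum-replicate-zero)

  first : ∀ {n} → Fin n → ∃[ k ] toℕ {n} k ≡ 0
  first {suc n} _ = zero , refl

  module SmoothedGap {n} (G : LossyFlowGraph n) (S : Spectrum (normalizedLaplacian (smoothed G)))
    {j : Fin n} (j≡2 : suc (toℕ j) ≡ 2) where

    module H = LossyFlow (smoothed G)
    d̄ : Vec n
    d̄ = degree (smoothed G)
    module HS = H.Scaled d̄
    open Spectral HS.scaled-sym S public

    0≤μⱼ : 0# ≤ μ j
    0≤μⱼ = ≤-substʳ (quadForm-f j) (HS.quadForm-scaled-nonNeg (f j))

    μⱼ≤2 : μ j ≤ num 2
    μⱼ≤2 = ≤-subst₂ (quadForm-f j)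
      (trans (cong (num 2 *_) (‖f‖² j)) (trans (*-comm (num 2) 1#) (*-identityˡ (num 2))))
      (HS.quadForm-scaled-≤2 H.degree-nonNeg (λ _ → ≤-refl) (f j))

    module Positive (μⱼ≢0 : μ j ≢ 0#) where

      open SecondPositive j≡2 0≤μⱼ μⱼ≢0 public

      √d̄ : Vec n
      √d̄ i = √ d̄ i

      √d̄-square : ∀ i → √d̄ i * √d̄ i ≡ d̄ i
      √d̄-square i = √-square (H.degree-nonNeg i)

      √d̄-null : Null √d̄
      √d̄-null i = begin
        (normalizedLaplacian (smoothed G) ⊠ᵛ √d̄) i
          ≡⟨ HS.scaled-⊠ᵛ √d̄ i ⟩
        HS.t i * (laplacian (smoothed G) ⊠ᵛ z) i
          ≡⟨ cong (HS.t i *_) (H.laplacian-⊠ᵛ z i) ⟩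
        HS.t i * ∑[ e < H.m ] (H.w e * (H.B e i * H.flow z e))
          ≡⟨ cong (HS.t i *_) (trans (sum-cong-≗ {H.m} no-flow) (sum-replicate-zero H.m)) ⟩
        HS.t i * 0#
          ≡⟨ zeroʳ (HS.t i) ⟩
        0# ∎
        where
        open ≡-Reasoning
        z : Vec n
        z = HS.potential √d̄
        -- At an isolated vertex `z` is 0 instead of 1, but every edge there has weight 0. The case
        -- cannot be excluded yet, because `d̄≢0` rests on `√d̄-null`.
        absorb : ∀ e k → H.w e ≤ d̄ k → H.w e * z k ≡ H.w e
        absorb e k w≤d̄ = helper (d̄ k ≟ 0#)
          where
          helper : Dec (d̄ k ≡ 0#) → H.w e * z k ≡ H.w e
          helper (yes d̄≡0) = trans (cong (_* z k) w≡0) (trans (zeroˡ (z k)) (sym w≡0))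
            where
            w≡0 : H.w e ≡ 0#
            w≡0 = ≤-antisym (≤-substʳ d̄≡0 w≤d̄) (H.0≤w e)
          helper (no d̄≢0) = trans
            (cong (H.w e *_) (trans (*-comm (HS.t k) (√d̄ k)) (√*√⁻¹ (H.degree-nonNeg k) d̄≢0)))
            (trans (*-comm (H.w e) 1#) (*-identityˡ (H.w e)))
        no-flow : ∀ e → H.w e * (H.B e i * H.flow z e) ≡ 0#
        no-flow e = begin
          H.w e * (H.B e i * H.flow z e)
            ≡⟨ solve 4 (λ w c p q → w :* (c :* (p :- nat 1 :* q)) := c :* (w :* p :- w :* q)) refl
                 (H.w e) (H.B e i) (z (H.b e)) (z (H.a e)) ⟩
          H.B e i * (H.w e * z (H.b e) - H.w e * z (H.a e))
            ≡⟨ cong₂ (λ p q → H.B e i * (p - q))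
                 (absorb e (H.b e) (H.w≤degree-b e)) (absorb e (H.a e) (H.w≤degree-a e)) ⟩
          H.B e i * (H.w e - H.w e)
            ≡⟨ solve 2 (λ c w → c :* (w :- w) := nat 0) refl (H.B e i) (H.w e) ⟩
          0# ∎

      -- An isolated vertex would give a second null vector, orthogonal to √d̄.
      d̄≢0 : ∀ i → d̄ i ≢ 0#
      d̄≢0 i d̄ᵢ≡0 = μⱼ≢0 (≤-antisym μⱼ≤0 0≤μⱼ)
        where
        δ-null : Null (δ i)
        δ-null k = trans (HS.scaled-⊠ᵛ (δ i) k) (trans (cong (HS.t k *_)
          (trans (sum-cong-≗ {n} (λ l → trans (cong (laplacian (smoothed G) k l *_) (z≡0 l)) (zeroʳ _)))
            (sum-replicate-zero n)))
          (zeroʳ (HS.t k)))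
          where
          -- The convention `0⁻¹ = 0` is what puts the isolated vertex into the kernel.
          z≡0 : ∀ l → HS.t l * δ i l ≡ 0#
          z≡0 l with i Fin.≟ l
          ... | yes refl = trans (cong (_* 1#) (√⁻¹-zero d̄ᵢ≡0)) (zeroˡ 1#)
          ... | no  _    = zeroʳ (HS.t l)

        ‖δ‖²≢0 : ‖ δ i ‖² ≢ 0#
        ‖δ‖²≢0 p = 0≢1 (sym (trans (sym (trans (sum-δ (δ i) i) (δ-refl i))) p))

        √d̄⊥δ : ⟨ √d̄ , δ i ⟩ ≡ 0#
        √d̄⊥δ = trans (⟨⟩-comm √d̄ (δ i)) (trans (sum-δ √d̄ i) (x²≡0⇒x≡0 (trans (√d̄-square i) d̄ᵢ≡0)))

        k = proj₁ (first i)
        k≡0 = proj₂ (first i)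

        -- Both null vectors are multiples of the bottom eigenvector, yet orthogonal to each other;
        -- as `δ i` is nonzero, `√d̄` must vanish. Then all degrees are 0, and so are all energies
        -- and `μ j`.
        √d̄≡0 : ‖ √d̄ ‖² ≡ 0#
        √d̄≡0 = trans (null-parseval √d̄-null √d̄ k k≡0)
          (trans (cong (_* ⟨ √d̄ , f k ⟩) (null-orthogonal δ-null ‖δ‖²≢0 √d̄ √d̄⊥δ k k≡0)) (zeroˡ _))

        d̄≡0 : ∀ l → d̄ l ≡ 0#
        d̄≡0 l = trans (sym (√d̄-square l)) (trans (cong (_* √d̄ l) (‖‖²≡0 √d̄ √d̄≡0 l)) (zeroˡ (√d̄ l)))

        μⱼ≤0 : μ j ≤ 0#
        μⱼ≤0 = ≤-subst₂ (trans (sym (HS.quadForm-scaled (f j))) (quadForm-f j))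
          (trans (cong (num 2 *_) (trans
            (sum-cong-≗ {n} (λ l → trans (cong (_* (z l * z l)) (d̄≡0 l)) (zeroˡ (z l * z l))))
            (sum-replicate-zero n))) (zeroʳ (num 2)))
          (H.energy≤2degree z)
          where
          z : Vec n
          z = HS.potential (f j)

      √d̄-nonzero : ‖ √d̄ ‖² ≢ 0#
      √d̄-nonzero p = d̄≢0 j (trans (sym (√d̄-square j)) (trans (cong (_* √d̄ j) (‖‖²≡0 √d̄ p j)) (zeroˡ (√d̄ j))))

      -- The substitution y = D̄^{1/2} z turns weighted mean 0 into orthogonality to `√d̄`. It can
      -- be undone since no degree vanishes.
      poincaré : ∀ z → ∑[ i < n ] (d̄ i * z i) ≡ 0# → μ j * ∑[ i < n ] (d̄ i * (z i * z i)) ≤ H.energy z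
      poincaré z mean≡0 = ≤-subst₂
        (cong (μ j *_) (sum-cong-≗ {n} (λ i → trans
          (solve 2 (λ r z → r :* z :* (r :* z) := r :* r :* (z :* z)) refl (√d̄ i) (z i))
          (cong (_* (z i * z i)) (√d̄-square i)))))
        (trans (HS.quadForm-scaled y) (sum-cong-≗ {H.m} (λ e →
          cong₂ (λ p q → H.w e * ((p - 1# * q) * (p - 1# * q))) (potential-y (H.b e)) (potential-y (H.a e)))))
        (⊥null-≤ √d̄-null √d̄-nonzero y (trans
          (sum-cong-≗ {n} (λ i → trans
            (solve 2 (λ r z → r :* z :* r := r :* r :* z) refl (√d̄ i) (z i))
            (cong (_* z i) (√d̄-square i))))
          mean≡0))
        where
        y : Vec n
        y i = √d̄ i * z i
        potential-y : HS.potential y ≗ z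
        potential-y i = begin
          HS.t i * (√d̄ i * z i)   ≡⟨ solve 3 (λ t r z → t :* (r :* z) := r :* t :* z) refl (HS.t i) (√d̄ i) (z i) ⟩
          √d̄ i * HS.t i * z i     ≡⟨ cong (_* z i) (√*√⁻¹ (H.degree-nonNeg i) (d̄≢0 i)) ⟩
          1# * z i                ≡⟨ *-identityˡ (z i) ⟩
          z i                     ∎
          where open ≡-Reasoning

  -- Perturbation from the smoothed to the balanced lossy graph.

  module BalancedGap {n} (G : LossyFlowGraph n) (S : Spectrum (normalizedLaplacian (smoothed G)))
    {j : Fin n} (j≡2 : suc (toℕ j) ≡ 2) where

    open SmoothedGap G S j≡2
    module L = LossyFlow G

    module _ (μⱼ≢0 : μ j ≢ 0#) (balanced : ∀ e → num 20 * (L.η e - 1#) ≤ μ j)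
      {c₁ : ℝ} (0≤c₁ : 0# ≤ c₁) (d : Vec n) (0≤d : ∀ i → 0# ≤ d i)
      (degree≤d : degree G ≤ᵛ d) (d≤c₁degree : ∀ i → d i ≤ c₁ * degree G i) where

      open Positive μⱼ≢0
      module LS = L.Scaled d

      η-1 : Vec L.m
      η-1 e = L.η e - 1#

      0≤η-1 : ∀ e → 0# ≤ η-1 e
      0≤η-1 e = 0≤- (L.1≤η e)

      10η-1≤1 : ∀ e → num 10 * η-1 e ≤ 1#
      10η-1≤1 e = *-cancelˡ (num-nonNeg 2) 2≢0 (≤-subst₂
        (solve 1 (λ u → nat 20 :* u := nat 2 :* (nat 10 :* u)) refl (η-1 e))
        (solve 0 (nat 2 := nat 2 :* nat 1) refl)
        (≤-trans (balanced e) μⱼ≤2))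

      4η²≤5 : ∀ e → num 4 * (L.η e * L.η e) ≤ num 5
      4η²≤5 e = ≤-by (p + num 2 * u * (p + num 8 * u))
        (+-nonNeg 0≤p (*-nonNeg (*-nonNeg (num-nonNeg 2) (0≤η-1 e))
          (+-nonNeg 0≤p (*-nonNeg (num-nonNeg 8) (0≤η-1 e)))))
        (solve 1 (λ h → nat 5 := nat 4 :* (h :* h) :+
          ((nat 1 :- nat 10 :* (h :- nat 1)) :+
           nat 2 :* (h :- nat 1) :* ((nat 1 :- nat 10 :* (h :- nat 1)) :+ nat 8 :* (h :- nat 1))))
          refl (L.η e))
        where
        u = η-1 e
        p = 1# - num 10 * u
        0≤p = 0≤- (10η-1≤1 e)

      48[η-1]²≤μ : ∀ e → num 48 * (η-1 e * η-1 e) ≤ μ j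
      48[η-1]²≤μ e = ≤-by
        ((μ j - num 20 * u) + num 20 * u * (1# - num 10 * u) + num 152 * (u * u))
        (+-nonNeg (+-nonNeg (0≤- (balanced e))
          (*-nonNeg (*-nonNeg (num-nonNeg 20) (0≤η-1 e)) (0≤- (10η-1≤1 e))))
          (*-nonNeg (num-nonNeg 152) (0≤x² u)))
        (solve 2 (λ m u → m := nat 48 :* (u :* u) :+
          ((m :- nat 20 :* u) :+ nat 20 :* u :* (nat 1 :- nat 10 :* u) :+ nat 152 :* (u :* u)))
          refl (μ j) u)
        where u = η-1 e

      4degree≤5d̄ : ∀ i → num 4 * degree G i ≤ num 5 * d̄ i
      4degree≤5d̄ i = ≤-subst₂
        (trans (sym (*-distribˡ-sum {L.m} (num 4) _)) (cong (num 4 *_) (sym (L.degree≡ i))))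
        (trans (sym (*-distribˡ-sum {L.m} (num 5) _)) (cong (num 5 *_) (sym (H.degree≡ i))))
        (sum-mono (λ e → ≤-by
          (L.w e * (δ i (L.b e) + (num 5 - num 4 * (L.η e * L.η e)) * δ i (L.a e)))
          (*-nonNeg (L.0≤w e) (+-nonNeg (L.δ-nonNeg i (L.b e))
            (*-nonNeg (0≤- (4η²≤5 e)) (L.δ-nonNeg i (L.a e)))))
          (solve 4 (λ w p h q → nat 5 :* (w :* (p :+ nat 1 :* nat 1 :* q)) :=
            nat 4 :* (w :* (p :+ h :* h :* q)) :+
            w :* (p :+ (nat 5 :- nat 4 :* (h :* h)) :* q))
            refl (L.w e) (δ i (L.b e)) (L.η e) (δ i (L.a e)))))

      d≢0 : ∀ i → d i ≢ 0#
      d≢0 i dᵢ≡0 = d̄≢0 i (≤-antisym (≤-substʳ dᵢ≡0 (≤-trans d̄≤degree (degree≤d i))) (H.degree-nonNeg i))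
        where
        d̄≤degree : d̄ i ≤ degree G i
        d̄≤degree = ≤-subst₂ (sym (H.degree≡ i)) (sym (L.degree≡ i)) (sum-mono (λ e → ≤-by
          (L.w e * ((L.η e * L.η e - 1#) * δ i (L.a e)))
          (*-nonNeg (L.0≤w e) (*-nonNeg (0≤- (L.1≤η² e)) (L.δ-nonNeg i (L.a e))))
          (solve 4 (λ w p h q → w :* (p :+ h :* h :* q) :=
            w :* (p :+ nat 1 :* nat 1 :* q) :+ w :* ((h :* h :- nat 1) :* q))
            refl (L.w e) (δ i (L.b e)) (L.η e) (δ i (L.a e)))))

      -- From 3 Q + 6 R ≥ 2 Q̄ ≥ 2 `μS` and 48 R ≤ `μS` follows 3 Q ≥ (2 - 1/8) `μS`, which is 8 Q ≥
      -- 5 `μS`.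
      balanced-poincaré : ∀ z → ∑[ i < n ] (d̄ i * z i) ≡ 0# →
        num 5 * (μ j * ∑[ i < n ] (d̄ i * (z i * z i))) ≤ num 8 * L.energy z
      balanced-poincaré z mean≡0 = *-cancelˡ (num-nonNeg 3) 3≢0 (≤-by
        ((num 3 * Q + num 6 * R - num 2 * Q̄) * num 8 + num 16 * (Q̄ - μS) + (μS - num 48 * R))
        (+-nonNeg (+-nonNeg
          (*-nonNeg (0≤- perturbation) (num-nonNeg 8))
          (*-nonNeg (num-nonNeg 16) (0≤- (poincaré z mean≡0))))
          (0≤- 48R≤μS))
        (solve 4 (λ Q R P m → nat 3 :* (nat 8 :* Q) := nat 3 :* (nat 5 :* m) :+
          ((nat 3 :* Q :+ nat 6 :* R :- nat 2 :* P) :* nat 8 :+ nat 16 :* (P :- m) :+ (m :- nat 48 :* R)))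
          refl Q R Q̄ μS))
        where
        u : Vec L.m
        u = η-1
        p q : Vec L.m
        p e = z (L.b e)
        q e = z (L.a e)
        Q Q̄ R μS : ℝ
        Q = L.energy z
        Q̄ = H.energy z
        R = ∑[ e < L.m ] (L.w e * (u e * u e * (q e * q e)))
        μS = μ j * ∑[ i < n ] (d̄ i * (z i * z i))

        3≢0 : num 3 ≢ 0#
        3≢0 = 1≤⇒≢0 (≤-by (num 2) (num-nonNeg 2) (solve 0 (nat 3 := nat 1 :+ nat 2) refl))

        -- 3 (A - B)² + 6 B² = 2 A² + (A - 3 B)² with A = p - q and B = (η - 1) q
        perturbation : num 2 * Q̄ ≤ num 3 * Q + num 6 * R
        perturbation = ≤-subst₂ (sym (*-distribˡ-sum {L.m} (num 2) _))
          (sum-linear {L.m} (num 3) _ (num 6) _)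
          (sum-mono (λ e → ≤-by
            (L.w e * ((p e - q e - num 3 * (u e * q e)) * (p e - q e - num 3 * (u e * q e))))
            (*-nonNeg (L.0≤w e) (0≤x² (p e - q e - num 3 * (u e * q e))))
            (solve 4 (λ w p h q →
              nat 3 :* (w :* ((p :- h :* q) :* (p :- h :* q))) :+
              nat 6 :* (w :* ((h :- nat 1) :* (h :- nat 1) :* (q :* q))) :=
              nat 2 :* (w :* ((p :- nat 1 :* q) :* (p :- nat 1 :* q))) :+
              w :* ((p :- q :- nat 3 :* ((h :- nat 1) :* q)) :* (p :- q :- nat 3 :* ((h :- nat 1) :* q))))
              refl (L.w e) (p e) (L.η e) (q e))))

        48R≤μS : num 48 * R ≤ μS
        48R≤μS = ≤-subst₂ (sym (*-distribˡ-sum {L.m} (num 48) _))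
          (trans (sym (*-distribˡ-sum {L.m} (μ j) _))
            (cong (μ j *_) (sym (H.degree-sum (λ i → z i * z i)))))
          (sum-mono (λ e → ≤-by
            (L.w e * (μ j * (p e * p e) + (μ j - num 48 * (u e * u e)) * (q e * q e)))
            (*-nonNeg (L.0≤w e) (+-nonNeg (*-nonNeg 0≤μⱼ (0≤x² (p e)))
              (*-nonNeg (0≤- (48[η-1]²≤μ e)) (0≤x² (q e)))))
            (solve 5 (λ w p u q m →
              m :* (w :* (p :* p :+ nat 1 :* nat 1 :* (q :* q))) :=
              nat 48 :* (w :* (u :* u :* (q :* q))) :+
              w :* (m :* (p :* p) :+ (m :- nat 48 :* (u :* u)) :* (q :* q)))
              refl (L.w e) (p e) (u e) (q e) (μ j))))

      s : Vec n
      s i = LS.t i * d̄ i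

      -- The fives cancel: 4 ‖y‖² ≤ 5 c₁ S̄ by comparing degrees, and 5 μ S̄ is at most 8 times the
      -- energy, so 4 μ ‖y‖² is at most 8 c₁ times the energy.
      scaled-gap : ∀ y → ⟨ y , s ⟩ ≡ 0# →
                   μ j * ‖ y ‖² ≤ num 2 * c₁ * quadForm (scaledLaplacian d G) y
      scaled-gap y y⊥s = *-cancelˡ (num-nonNeg 4) 4≢0 (≤-by
        (μ j * (num 5 * c₁ * S̄ - num 4 * ‖ y ‖²) + c₁ * (num 8 * L.energy z - num 5 * (μ j * S̄)))
        (+-nonNeg (*-nonNeg 0≤μⱼ (0≤- 4‖y‖²≤)) (*-nonNeg 0≤c₁ (0≤- (balanced-poincaré z z-mean))))
        (trans (cong (λ p → num 4 * (num 2 * c₁ * p)) (LS.quadForm-scaled y))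
          (solve 5 (λ c Q m S k → nat 4 :* (nat 2 :* c :* Q) := nat 4 :* (m :* k) :+
            (m :* (nat 5 :* c :* S :- nat 4 :* k) :+ c :* (nat 8 :* Q :- nat 5 :* (m :* S))))
            refl c₁ (L.energy z) (μ j) S̄ ‖ y ‖²)))
        where
        z : Vec n
        z = LS.potential y
        S̄ : ℝ
        S̄ = ∑[ i < n ] (d̄ i * (z i * z i))

        4≢0 : num 4 ≢ 0#
        4≢0 = 1≤⇒≢0 (≤-by (num 3) (num-nonNeg 3) (solve 0 (nat 4 := nat 1 :+ nat 3) refl))

        z-mean : ∑[ i < n ] (d̄ i * z i) ≡ 0#
        z-mean = trans
          (sum-cong-≗ {n} (λ i → solve 3 (λ d t y → d :* (t :* y) := y :* (t :* d)) refl (d̄ i) (LS.t i) (y i)))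
          y⊥s

        y²≡dz² : ∀ i → y i * y i ≡ d i * (z i * z i)
        y²≡dz² i = begin
          y i * y i                             ≡⟨ *-identityˡ (y i * y i) ⟨
          1# * (y i * y i)                      ≡⟨ cong (_* (y i * y i)) (x*√⁻¹² (0≤d i) (d≢0 i)) ⟨
          d i * (LS.t i * LS.t i) * (y i * y i) ≡⟨ solve 3 (λ d t y → d :* (t :* t) :* (y :* y) := d :* (t :* y :* (t :* y))) refl (d i) (LS.t i) (y i) ⟩
          d i * (z i * z i)                     ∎
          where open ≡-Reasoning

        4‖y‖²≤ : num 4 * ‖ y ‖² ≤ num 5 * c₁ * S̄
        4‖y‖²≤ = ≤-subst₂ (sym (*-distribˡ-sum {n} (num 4) _)) (sym (*-distribˡ-sum {n} (num 5 * c₁) _))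
          (sum-mono (λ i → ≤-by
            ((num 4 * (c₁ * degree G i - d i) + c₁ * (num 5 * d̄ i - num 4 * degree G i)) * (z i * z i))
            (*-nonNeg (+-nonNeg (*-nonNeg (num-nonNeg 4) (0≤- (d≤c₁degree i)))
              (*-nonNeg 0≤c₁ (0≤- (4degree≤5d̄ i)))) (0≤x² (z i)))
            (trans
              (solve 5 (λ c d g e z → nat 5 :* c :* (e :* (z :* z)) :=
                nat 4 :* (d :* (z :* z)) :+
                (nat 4 :* (c :* g :- d) :+ c :* (nat 5 :* e :- nat 4 :* g)) :* (z :* z))
                refl c₁ (d i) (degree G i) (d̄ i) (z i))
              (cong (λ p → num 4 * p + (num 4 * (c₁ * degree G i - d i) +
                c₁ * (num 5 * d̄ i - num 4 * degree G i)) * (z i * z i)) (sym (y²≡dz² i))))))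

-- The two Loewner bounds.

module Preconditioner (reals : RealNumbers) where

  open OverReals reals
  open OrderedField
  open RealAlgebra reals
  open LinearAlgebra reals
  open Graphs reals
  open Deflation reals
  open SpectralGap reals

  ⪯-intro : ∀ {n} {M N : Matrix n n} → Symmetric M → Symmetric N →
            (∀ x → quadForm M x ≤ quadForm N x) → M ⪯ N
  ⪯-intro {M = M} {N} M-sym N-sym M≤N = record
    { symmetric = λ i j → cong₂ _-_ (N-sym i j) (M-sym i j)
    ; nonNeg    = λ x → ≤-substʳ (sym (quadForm-⊟ N M x)) (0≤- (M≤N x))
    }

  module RankOne {n} (v : Vec n) (v-unit : IsUnit v) (r : ℝ) where

    P : Matrix n n
    P = I ⊟ (1# - r) ⊡ outer v v

    P-sym : Symmetric P
    P-sym i j = cong₂ (λ p q → p - (1# - r) * q) (δ-sym i j) (*-comm (v i) (v j))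

    quadForm-P : ∀ x → quadForm P x ≡ (‖ x ‖² - ⟨ x , v ⟩ * ⟨ x , v ⟩) + r * (⟨ x , v ⟩ * ⟨ x , v ⟩)
    quadForm-P x = trans (quadForm-⊟ I ((1# - r) ⊡ outer v v) x) (trans
      (cong₂ _-_ (quadForm-I x)
        (trans (quadForm-⊡ (1# - r) (outer v v) x) (cong ((1# - r) *_) (quadForm-outer v x))))
      (solve 3 (λ n r a → n :- (nat 1 :- r) :* a := (n :- a) :+ r :* a) refl
        ‖ x ‖² r (⟨ x , v ⟩ * ⟨ x , v ⟩)))

    ‖rejection‖² : ∀ x → ‖ lin 1# x (- ⟨ x , v ⟩) v ‖² ≡ ‖ x ‖² - ⟨ x , v ⟩ * ⟨ x , v ⟩
    ‖rejection‖² x = trans (‖lin‖² 1# x (- ⟨ x , v ⟩) v refl refl v-unit)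
      (solve 2 (λ n a →
        nat 1 :* nat 1 :* n :+ nat 2 :* (nat 1 :* (:- a) :* a) :+ (:- a) :* (:- a) :* nat 1 :=
        n :- a :* a) refl ‖ x ‖² ⟨ x , v ⟩)

    0≤‖rejection‖² : ∀ x → 0# ≤ ‖ x ‖² - ⟨ x , v ⟩ * ⟨ x , v ⟩
    0≤‖rejection‖² x = ≤-substʳ (‖rejection‖² x) (‖‖²-nonNeg (lin 1# x (- ⟨ x , v ⟩) v))

  -- With x = u + α v and its reflection w = u - α v, the parallelogram law gives xᵀMx + wᵀMw = 2
  -- uᵀMu + 2 ℓ α²; dropping wᵀMw removes the cross term.
  quadForm≤6P : ∀ {n} {M : Matrix n n} → Symmetric M → (∀ x → 0# ≤ quadForm M x) →
    (∀ x → quadForm M x ≤ num 3 * ‖ x ‖²) → ∀ (v : Vec n) (v-unit : IsUnit v) x →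
    quadForm M x ≤ num 6 * quadForm (RankOne.P v v-unit (quadForm M v)) x
  quadForm≤6P {n} {M} M-sym M-nonNeg M≤3 v v-unit x = ≤-by
    (quadForm M w + num 2 * (num 3 * ‖ u ‖² - quadForm M u) + num 4 * (ℓ * (α * α)))
    (+-nonNeg (+-nonNeg (M-nonNeg w) (*-nonNeg (num-nonNeg 2) (0≤- (M≤3 u))))
      (*-nonNeg (num-nonNeg 4) (*-nonNeg (M-nonNeg v) (0≤x² α))))
    (trans (cong (num 6 *_) (quadForm-P x)) (trans
      (solve 5 (λ X N c ℓ a →
        nat 6 :* (N :- a :* a :+ ℓ :* (a :* a)) := X :+
        ((nat 1 :* nat 1 :* X :+ nat 2 :* (nat 1 :* (:- (nat 2 :* a)) :* c) :+
            (:- (nat 2 :* a)) :* (:- (nat 2 :* a)) :* ℓ) :+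
          nat 2 :* (nat 3 :* (N :- a :* a) :-
            (nat 1 :* nat 1 :* X :+ nat 2 :* (nat 1 :* (:- a) :* c) :+ (:- a) :* (:- a) :* ℓ)) :+
          nat 4 :* (ℓ :* (a :* a))))
        refl (quadForm M x) ‖ x ‖² ⟨ x , M ⊠ᵛ v ⟩ ℓ α)
      (cong₃ (λ p q r → quadForm M x + (p + num 2 * (num 3 * q - r) + num 4 * (ℓ * (α * α))))
        (sym (quadForm-lin M-sym 1# x (- (num 2 * α)) v))
        (sym (‖rejection‖² x))
        (sym (quadForm-lin M-sym 1# x (- α) v)))))
    where
    ℓ α : ℝ
    ℓ = quadForm M v
    α = ⟨ x , v ⟩
    open RankOne v v-unit ℓ
    u w : Vec n
    u = lin 1# x (- α) v
    w = lin 1# x (- (num 2 * α)) v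
    cong₃ : ∀ (f : ℝ → ℝ → ℝ → ℝ) {a a′ b b′ c c′} → a ≡ a′ → b ≡ b′ → c ≡ c′ → f a b c ≡ f a′ b′ c′
    cong₃ f refl refl refl = refl

  *-/-cancel : ∀ {a c} p → c ≢ 0# → c * ((a / c) * p) ≡ a * p
  *-/-cancel {a} {c} p c≢0 = begin
    c * (a * c ⁻¹ * p)   ≡⟨ solve 4 (λ c a i p → c :* (a :* i :* p) := (c :* i) :* (a :* p)) refl c a (c ⁻¹) p ⟩
    c * c ⁻¹ * (a * p)   ≡⟨ cong (_* (a * p)) (*-inverseʳ c≢0) ⟩
    1# * (a * p)         ≡⟨ *-identityˡ (a * p) ⟩
    a * p                ∎
    where open ≡-Reasoning

  /-≤ : ∀ {a c p x} → 0# ≤ c → c ≢ 0# → a * p ≤ c * x → (a / c) * p ≤ x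
  /-≤ {p = p} 0≤c c≢0 ap≤cx = *-cancelˡ 0≤c c≢0 (≤-substˡ (sym (*-/-cancel p c≢0)) ap≤cx)

  ≤-/ : ∀ {a c p x} → 0# ≤ c → c ≢ 0# → c * x ≤ a * p → x ≤ (a / c) * p
  ≤-/ {p = p} 0≤c c≢0 cx≤ap = *-cancelˡ 0≤c c≢0 (≤-substʳ (sym (*-/-cancel p c≢0)) cx≤ap)

  1≤* : ∀ {x y} → 1# ≤ x → 1# ≤ y → 1# ≤ x * y
  1≤* {x} {y} 1≤x 1≤y = ≤-trans 1≤y (≤-substˡ (*-identityˡ y) (*-monoʳ (≤-trans 0≤1 1≤y) 1≤x))

  module Main {n} (G : LossyFlowGraph n) {c₁ c₂ ε β : ℝ} (d v : Vec n)
    (1≤c₁ : 1# ≤ c₁) (1≤c₂ : 1# ≤ c₂) (0≤ε : 0# ≤ ε) (ε≤1 : ε ≤ 1#)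
    (balanced : Balanced β G)
    (S₂ : Spectrum (normalizedLaplacian (smoothed G))) {j : Fin n} (j≡2 : suc (toℕ j) ≡ 2)
    (20β≤λ₂ : fromℕ 20 * β ≤ Spectrum.eigenvalue S₂ j)
    (0≤d : ∀ i → 0# ≤ d i) (degree≤d : degree G ≤ᵛ d) (d≤c₁degree : ∀ i → d i ≤ c₁ * degree G i)
    (v-unit : IsUnit v)
    (S₁ : Spectrum (scaledLaplacian d G ⊞ ε ⊡ I)) {i : Fin n} (i≡1 : suc (toℕ i) ≡ 1)
    (approximate : quadForm (scaledLaplacian d G ⊞ ε ⊡ I) v ≤ c₂ * Spectrum.eigenvalue S₁ i) where

    A M : Matrix n n
    A = scaledLaplacian d G
    M = A ⊞ ε ⊡ I

    module L = LossyFlow G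
    module LS = L.Scaled d

    M-sym : Symmetric M
    M-sym k l = cong₂ (λ p q → p + ε * q) (LS.scaled-sym k l) (δ-sym k l)

    quadForm-M : ∀ x → quadForm M x ≡ quadForm A x + ε * ‖ x ‖²
    quadForm-M x = trans (quadForm-⊞⊡ A ε I x) (cong (λ p → quadForm A x + ε * p) (quadForm-I x))

    A≤M : ∀ x → quadForm A x ≤ quadForm M x
    A≤M x = ≤-by _ (*-nonNeg 0≤ε (‖‖²-nonNeg x)) (quadForm-M x)

    M-nonNeg : ∀ x → 0# ≤ quadForm M x
    M-nonNeg x = ≤-trans (LS.quadForm-scaled-nonNeg x) (A≤M x)

    M≤3 : ∀ x → quadForm M x ≤ num 3 * ‖ x ‖²
    M≤3 x = ≤-subst₂ (sym (quadForm-M x))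
      (solve 1 (λ n → nat 2 :* n :+ nat 1 :* n := nat 3 :* n) refl ‖ x ‖²)
      (+-mono (LS.quadForm-scaled-≤2 0≤d degree≤d x) (*-monoʳ (‖‖²-nonNeg x) ε≤1))

    module S = SmoothedGap G S₂ j≡2
    module F = Spectral M-sym S₁

    λ₂ λ₁ ℓ : ℝ
    λ₂ = S.μ j
    λ₁ = F.μ i
    ℓ = quadForm M v

    open RankOne v v-unit ℓ

    0≤c₁ : 0# ≤ c₁
    0≤c₁ = ≤-trans 0≤1 1≤c₁

    0≤c₂ : 0# ≤ c₂
    0≤c₂ = ≤-trans 0≤1 1≤c₂

    0≤λ₁ : 0# ≤ λ₁
    0≤λ₁ = ≤-substʳ (F.quadForm-f i) (M-nonNeg (F.f i))

    20[η-1]≤λ₂ : ∀ e → num 20 * (L.η e - 1#) ≤ λ₂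
    20[η-1]≤λ₂ e = ≤-trans
      (*-monoˡ (num-nonNeg 20) (≤-substʳ
        (solve 1 (λ b → (nat 1 :+ b) :- nat 1 := b) refl β) (+-monoˡ-≤ (- 1#) (balanced e))))
      (≤-substˡ (cong (_* β) (fromℕ≡num 20)) 20β≤λ₂)

    0≤P : ∀ x → 0# ≤ quadForm P x
    0≤P x = ≤-substʳ (sym (quadForm-P x))
      (+-nonNeg (0≤‖rejection‖² x) (*-nonNeg (M-nonNeg v) (0≤x² ⟨ x , v ⟩)))

    -- The gap is proved for `A` and weakened to `M`, because `v` and `λ₁` belong to `M`; hence `K`
    -- is 2 c₁, without ε.
    rejection-≤ : λ₂ ≢ 0# → ∀ x →
      λ₂ * (‖ x ‖² - ⟨ x , v ⟩ * ⟨ x , v ⟩) ≤ num 2 * c₁ * (1# + c₂) * quadForm M x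
    rejection-≤ λ₂≢0 = LowestEigenvector.ApproximateMinimizer.distance-≤
      M-sym (F.f i) (F.‖f‖² i) (λ x → F.⟨,Mf⟩ x i) (F.first-≤ i≡1) s 0≤2c₁
      (λ y y⊥s → ≤-trans (scaled-gap y y⊥s) (*-monoˡ 0≤2c₁ (A≤M y)))
      v v-unit 1≤c₂ 0≤λ₁ S.0≤μⱼ approximate
      where
      0≤2c₁ = *-nonNeg (num-nonNeg 2) 0≤c₁
      s = BalancedGap.s G S₂ j≡2 λ₂≢0 20[η-1]≤λ₂ 0≤c₁ d 0≤d degree≤d d≤c₁degree
      scaled-gap = BalancedGap.scaled-gap G S₂ j≡2 λ₂≢0 20[η-1]≤λ₂ 0≤c₁ d 0≤d degree≤d d≤c₁degree

    projection-≤ : ∀ x → ℓ * (⟨ x , v ⟩ * ⟨ x , v ⟩) ≤ c₂ * quadForm M x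
    projection-≤ x = ≤-trans (*-monoʳ (0≤x² ⟨ x , v ⟩) approximate) (≤-substˡ (sym (*-assoc c₂ λ₁ _))
      (*-monoˡ 0≤c₂ (≤-trans (*-monoˡ 0≤λ₁ α²≤‖x‖²) (F.first-≤ i≡1 x))))
      where
      α²≤‖x‖² : ⟨ x , v ⟩ * ⟨ x , v ⟩ ≤ ‖ x ‖²
      α²≤‖x‖² = ≤-by _ (0≤‖rejection‖² x)
        (solve 2 (λ n a → n := a :+ (n :- a)) refl ‖ x ‖² (⟨ x , v ⟩ * ⟨ x , v ⟩))

    C : ℝ
    C = fromℕ 12 * c₁ ^ 2 * c₂ ^ 2

    C≡ : C ≡ num 12 * ((c₁ * c₂) * (c₁ * c₂))
    C≡ = trans (cong (λ p → p * c₁ ^ 2 * c₂ ^ 2) (fromℕ≡num 12))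
      (solve 2 (λ a b → nat 12 :* (a :* (a :* nat 1)) :* (b :* (b :* nat 1)) :=
        nat 12 :* ((a :* b) :* (a :* b))) refl c₁ c₂)

    1≤c₁c₂ : 1# ≤ c₁ * c₂
    1≤c₁c₂ = 1≤* 1≤c₁ 1≤c₂

    1≤12 : 1# ≤ num 12
    1≤12 = ≤-by (num 11) (num-nonNeg 11) (solve 0 (nat 12 := nat 1 :+ nat 11) refl)

    1≤C : 1# ≤ C
    1≤C = ≤-substʳ (sym C≡) (1≤* 1≤12 (1≤* 1≤c₁c₂ 1≤c₁c₂))

    -- The lower bound with the denominator cleared; `U-part` contributes 8 and `V-part` 4 to the
    -- factor 12.
    λ₂²P≤CM : ∀ x → λ₂ ^ 2 * quadForm P x ≤ C * quadForm M x
    λ₂²P≤CM x = helper (λ₂ ≟ 0#)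
      where
      X U V : ℝ
      X = quadForm M x
      U = ‖ x ‖² - ⟨ x , v ⟩ * ⟨ x , v ⟩
      V = ℓ * (⟨ x , v ⟩ * ⟨ x , v ⟩)

      c₂≤c₁c₂ : c₂ ≤ c₁ * c₂
      c₂≤c₁c₂ = ≤-substˡ (*-identityˡ c₂) (*-monoʳ 0≤c₂ 1≤c₁)

      c₁c₂≤[c₁c₂]² : c₁ * c₂ ≤ (c₁ * c₂) * (c₁ * c₂)
      c₁c₂≤[c₁c₂]² = ≤-substˡ (*-identityˡ (c₁ * c₂)) (*-monoʳ (≤-trans 0≤1 1≤c₁c₂) 1≤c₁c₂)

      λ₂²≤2λ₂ : λ₂ * λ₂ ≤ num 2 * λ₂
      λ₂²≤2λ₂ = *-monoʳ S.0≤μⱼ S.μⱼ≤2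

      λ₂²≤4 : λ₂ * λ₂ ≤ num 4
      λ₂²≤4 = ≤-trans λ₂²≤2λ₂ (≤-substʳ (solve 0 (nat 2 :* nat 2 := nat 4) refl)
        (*-monoˡ (num-nonNeg 2) S.μⱼ≤2))

      V-part : λ₂ * λ₂ * V ≤ num 4 * (c₁ * c₂ * (c₁ * c₂)) * X
      V-part = ≤-trans (*-monoʳ (*-nonNeg (M-nonNeg v) (0≤x² ⟨ x , v ⟩)) λ₂²≤4)
        (≤-substʳ (sym (*-assoc (num 4) _ X)) (*-monoˡ (num-nonNeg 4)
          (≤-trans (projection-≤ x) (*-monoʳ (M-nonNeg x) (≤-trans c₂≤c₁c₂ c₁c₂≤[c₁c₂]²)))))

      c₁[1+c₂]≤ : c₁ * (1# + c₂) ≤ num 2 * (c₁ * c₂ * (c₁ * c₂))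
      c₁[1+c₂]≤ = ≤-by
        (c₁ * (c₂ - 1#) + num 2 * ((c₁ * c₂) * (c₁ * c₂) - c₁ * c₂))
        (+-nonNeg (*-nonNeg 0≤c₁ (0≤- 1≤c₂)) (*-nonNeg (num-nonNeg 2) (0≤- c₁c₂≤[c₁c₂]²)))
        (solve 2 (λ a b → nat 2 :* (a :* b :* (a :* b)) := a :* (nat 1 :+ b) :+
          (a :* (b :- nat 1) :+ nat 2 :* ((a :* b) :* (a :* b) :- a :* b))) refl c₁ c₂)

      U-part : λ₂ ≢ 0# → λ₂ * λ₂ * U ≤ num 8 * (c₁ * c₂ * (c₁ * c₂)) * X
      U-part λ₂≢0 = ≤-trans (*-monoʳ (0≤‖rejection‖² x) λ₂²≤2λ₂)
        (≤-trans (≤-substˡ (sym (*-assoc (num 2) λ₂ U)) (*-monoˡ (num-nonNeg 2) (rejection-≤ λ₂≢0 x)))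
          (≤-subst₂
            (solve 3 (λ a b X → nat 4 :* (a :* (nat 1 :+ b) :* X) :=
              nat 2 :* (nat 2 :* a :* (nat 1 :+ b) :* X)) refl c₁ c₂ X)
            (solve 2 (λ a X → nat 4 :* (nat 2 :* a :* X) := nat 8 :* a :* X) refl (c₁ * c₂ * (c₁ * c₂)) X)
            (*-monoˡ (num-nonNeg 4) (*-monoʳ (M-nonNeg x) c₁[1+c₂]≤))))

      helper : Dec (λ₂ ≡ 0#) → λ₂ ^ 2 * quadForm P x ≤ C * X
      helper (yes λ₂≡0) = ≤-substˡ
        (sym (trans (cong (λ p → p ^ 2 * quadForm P x) λ₂≡0)
          (trans (cong (_* quadForm P x) (zeroˡ (0# * 1#))) (zeroˡ (quadForm P x)))))
        (*-nonNeg (≤-trans 0≤1 1≤C) (M-nonNeg x))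
      helper (no λ₂≢0) = ≤-subst₂
        (trans (solve 3 (λ m U V → m :* m :* U :+ m :* m :* V := m :* (m :* nat 1) :* (U :+ V)) refl λ₂ U V)
          (cong (λ₂ ^ 2 *_) (sym (quadForm-P x))))
        (trans (solve 2 (λ a X → nat 8 :* a :* X :+ nat 4 :* a :* X := nat 12 :* a :* X) refl
            (c₁ * c₂ * (c₁ * c₂)) X)
          (cong (_* X) (sym C≡)))
        (+-mono (U-part λ₂≢0) V-part)

    lower : (λ₂ ^ 2 / C) ⊡ P ⪯ M
    lower = ⪯-intro (λ k l → cong ((λ₂ ^ 2 / C) *_) (P-sym k l)) M-sym (λ x →
      ≤-substˡ (sym (quadForm-⊡ (λ₂ ^ 2 / C) P x)) (/-≤ (≤-trans 0≤1 1≤C) (1≤⇒≢0 1≤C) (λ₂²P≤CM x)))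

    -- At `λ₂` = 0 the bound should be infinite, but `0⁻¹ = 0` would make the right-hand side the
    -- zero matrix; the premise rules this out.
    upper : λ₂ ≢ 0# → M ⪯ ((fromℕ 24 * c₁ * c₂ / λ₂) ⊡ P)
    upper λ₂≢0 = ⪯-intro M-sym (λ k l → cong ((fromℕ 24 * c₁ * c₂ / λ₂) *_) (P-sym k l)) (λ x →
      ≤-substʳ (sym (quadForm-⊡ (fromℕ 24 * c₁ * c₂ / λ₂) P x)) (≤-/ S.0≤μⱼ λ₂≢0 (λ₂M≤ x)))
      where
      λ₂M≤ : ∀ x → λ₂ * quadForm M x ≤ fromℕ 24 * c₁ * c₂ * quadForm P x
      λ₂M≤ x = ≤-trans (*-monoʳ (M-nonNeg x) S.μⱼ≤2)
        (≤-trans (*-monoˡ (num-nonNeg 2) (quadForm≤6P M-sym M-nonNeg M≤3 v v-unit x))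
          (≤-subst₂
            (solve 1 (λ p → nat 12 :* p := nat 2 :* (nat 6 :* p)) refl (quadForm P x))
            (cong (λ p → p * c₁ * c₂ * quadForm P x) (sym (fromℕ≡num 24)))
            (*-monoʳ (0≤P x) 12≤24c₁c₂)))
        where
        12≤24c₁c₂ : num 12 ≤ num 24 * c₁ * c₂
        12≤24c₁c₂ = ≤-by (num 24 * (c₁ * c₂ - 1#) + num 12)
          (+-nonNeg (*-nonNeg (num-nonNeg 24) (0≤- 1≤c₁c₂)) (num-nonNeg 12))
          (solve 2 (λ a b → nat 24 :* a :* b := nat 12 :+ (nat 24 :* (a :* b :- nat 1) :+ nat 12)) refl c₁ c₂)

theorem4p1 :
    (reals : RealNumbers) → let open OverReals reals in
    (n : ℕ) (G : LossyFlowGraph n)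
    (c₁ c₂ ε β : ℝ) (d v : Vec n) (λ₁ λ₂ : ℝ) →
    let M = scaledLaplacian d G ⊞ ε ⊡ I
        ℓ = quadForm M v
        P = I ⊟ (1# - ℓ) ⊡ outer v v
    in
    1# ≤ c₁ →
    1# ≤ c₂ →
    0# ≤ ε →
    ε ≤ 1# →
    Balanced β G →
    λ₂ Isλ[ 2 ] normalizedLaplacian (smoothed G) →
    fromℕ 20 * β ≤ λ₂ →
    (∀ i → 0# ≤ d i) →
    degree G ≤ᵛ d →
    (∀ i → d i ≤ c₁ * degree G i) →
    IsUnit v →
    λ₁ Isλ[ 1 ] M →
    ℓ ≤ c₂ * λ₁ →
    ((λ₂ ^ 2 / (fromℕ 12 * c₁ ^ 2 * c₂ ^ 2)) ⊡ P ⪯ M)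
    × (λ₂ ≢ 0# → M ⪯ ((fromℕ 24 * c₁ * c₂ / λ₂) ⊡ P))
theorem4p1 reals n G c₁ c₂ ε β d v λ₁ λ₂ 1≤c₁ 1≤c₂ 0≤ε ε≤1 balanced
  (S₂ , j , j≡2 , refl) 20β≤λ₂ 0≤d degree≤d d≤c₁degree v-unit (S₁ , i , i≡1 , refl) approximate =
  lower , upper
  where
  open Preconditioner.Main reals G d v 1≤c₁ 1≤c₂ 0≤ε ε≤1 balanced S₂ j≡2 20β≤λ₂
    0≤d degree≤d d≤c₁degree v-unit S₁ i≡1 approximate using (lower; upper)
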